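{- Let $D$ be a $3$-anti-circulant digraph. If $D$ contains no induced subdigraph that is a blocking odd cycle, then $D$ is BE-diperfect.
   Context: All digraphs are finite, without loops and without multiple arcs (a pair of opposite arcs $uv$, $vu$, called a digon, is allowed). $u\to v$ means $uv$ is an arc. A path is a sequence of distinct vertices $v_1v_2\dots v_k$ with $v_iv_{i+1}$ an arc for all $i$; it starts at $v_1$ and ends at $v_k$. A stable set is a set of pairwise non-adjacent vertices. A path partition of $D$ is a collection of vertex-disjoint paths covering $V(D)$. For a stable set $S$, an $S_{BE}$-path partition is a path partition in which every path contains exactly one vertex of $S$ and every vertex of $S$ is the first or the last vertex of its path. $D$ satisfies the BE-property if for every maximum stable set $S$ of $D$ there is an $S_{BE}$-path partition; $D$ is BE-diperfect if every induced subdigraph of $D$ satisfies the BE-property. An anti-$P_4$ is a set of four distinct vertices $v_1,v_2,v_3,v_4$ with $v_1\to v_2$, $v_3\to v_2$, $v_3\to v_4$ (written $v_1\to v_2\leftarrow v_3\to v_4$). $D$ is $3$-anti-circulant if for every anti-$P_4$ $v_1\to v_2\leftarrow v_3\to v_4$ in $D$ we have $v_4\to v_1$. A blocking odd cycle is a digraph $C$ whose underlying simple graph is a cycle $x_1x_2\dots x_{2k+1}x_1$ with $k\ge 1$, such that $x_1$ is a source (no in-neighbours in $C$) and $x_2$ is a sink (no out-neighbours in $C$). -}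

module Defs where

open import Data.Nat using (ℕ; zero; suc; _+_; _*_; _≤_; _%_)
open import Data.Fin using (Fin; toℕ)
open import Data.Fin.Subset using (Subset; _∈_; _∉_; ∣_∣)
open import Data.Bool using (Bool; T; false)
open import Data.List using (List; []; _∷_; _∷ʳ_; concat; allFin)
open import Data.List.Relation.Unary.All using (All)
open import Data.List.Relation.Binary.Permutation.Propositional using (_↭_)
open import Data.Product using (Σ; ∃; _×_)
open import Data.Sum using (_⊎_)
open import Relation.Nullary using (¬_)
open import Relation.Binary.PropositionalEquality using (_≡_; _≢_)
open import Function.Definitions using (Injective)

record Digraph : Set where
  field
    n        : ℕ
    arc      : Fin n → Fin n → Bool
    loopless : ∀ v → arc v v ≡ false

open Digraph public

module Props (D : Digraph) where

  _⇒_ : Fin (n D) → Fin (n D) → Set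
  u ⇒ v = T (arc D u v)

  Adjacent : Fin (n D) → Fin (n D) → Set
  Adjacent u v = (u ⇒ v) ⊎ (v ⇒ u)

  Linked : List (Fin (n D)) → Set
  Linked []           = Data.Unit.⊤ where import Data.Unit
  Linked (u ∷ [])     = Data.Unit.⊤ where import Data.Unit
  Linked (u ∷ v ∷ vs) = (u ⇒ v) × Linked (v ∷ vs)

  -- a path: nonempty sequence of vertices with arcs between consecutive
  -- ones (distinctness is enforced by the partition condition below)
  IsWalkSeq : List (Fin (n D)) → Set
  IsWalkSeq []       = Data.Empty.⊥ where import Data.Empty
  IsWalkSeq (v ∷ vs) = Linked (v ∷ vs)

  -- a path partition: nonempty arc-linked sequences whose concatenation
  -- is a permutation of V(D) (so they are vertex-disjoint paths covering V(D))
  PathPartition : List (List (Fin (n D))) → Set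
  PathPartition Ps = All IsWalkSeq Ps × (concat Ps ↭ allFin (n D))

  Stable : Subset (n D) → Set
  Stable S = ∀ u v → u ∈ S → v ∈ S → ¬ Adjacent u v

  MaximumStable : Subset (n D) → Set
  MaximumStable S = Stable S × (∀ S′ → Stable S′ → ∣ S′ ∣ ≤ ∣ S ∣)

  BEPath : Subset (n D) → List (Fin (n D)) → Set
  BEPath S P =
      (∃ λ s → ∃ λ rest → (P ≡ s ∷ rest) × s ∈ S × All (_∉ S) rest)
    ⊎ (∃ λ s → ∃ λ rest → (P ≡ rest ∷ʳ s) × s ∈ S × All (_∉ S) rest)

  BEPathPartition : Subset (n D) → List (List (Fin (n D))) → Set
  BEPathPartition S Ps = PathPartition Ps × All (BEPath S) Ps

  BEProperty : Set
  BEProperty = ∀ S → MaximumStable S → ∃ λ Ps → BEPathPartition S Ps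


  ThreeAntiCirculant : Set
  ThreeAntiCirculant = ∀ v₁ v₂ v₃ v₄ →
    v₁ ≢ v₂ → v₁ ≢ v₃ → v₁ ≢ v₄ → v₂ ≢ v₃ → v₂ ≢ v₄ → v₃ ≢ v₄ →
    v₁ ⇒ v₂ → v₃ ⇒ v₂ → v₃ ⇒ v₄ → v₄ ⇒ v₁

  CycleNext : ∀ {m} → .{{_ : Data.Nat.NonZero m}} → Fin m → Fin m → Set
  CycleNext {m} i j = toℕ j ≡ suc (toℕ i) % m

  -- D contains an induced blocking odd cycle x₀ x₁ … x_{2k} x₀ with
  -- k = j + 1 ≥ 1 (length 2k+1 = 3 + 2j):
  -- the underlying simple graph of D[{x_i}] is exactly this cycle,
  -- x₀ is a source and x₁ is a sink in it.
  HasInducedBlockingOddCycle : Set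
  HasInducedBlockingOddCycle =
    Σ ℕ λ j → Σ (Fin (3 + 2 * j) → Fin (n D)) λ x →
      Injective _≡_ _≡_ x
      × (∀ a b → (Adjacent (x a) (x b) → CycleNext a b ⊎ CycleNext b a)
               × (CycleNext a b ⊎ CycleNext b a → Adjacent (x a) (x b)))
      × (∀ i → ¬ (x i ⇒ x Data.Fin.zero))
      × (∀ i → ¬ (x (Data.Fin.suc Data.Fin.zero) ⇒ x i))

open Props public

induced : (D : Digraph) (m : ℕ) (f : Fin m → Fin (n D)) → Digraph
induced D m f = record
  { n = m
  ; arc = λ i j → arc D (f i) (f j)
  ; loopless = λ i → loopless D (f i) }

BEDiperfect : Digraph → Set
BEDiperfect D = ∀ m (f : Fin m → Fin (n D)) → Injective _≡_ _≡_ f →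
                Props.BEProperty (induced D m f)

{-# OPTIONS --safe #-}

-- Of the blocking odd cycles only the transitive triangle matters. Let S be a maximum stable set and T its
-- complement, and argue by induction on the number of vertices. Whenever T contains an arc u → v such that u has
-- no other out-neighbour or v no other in-neighbour, a digon, or an arc u → v with u → z → v for some z, one or
-- two vertices of T can be deleted and reinserted into the paths obtained by induction.
-- Otherwise every arc u → v inside T satisfies: no vertex of S has an arc to v, or u has no arc to S. In the first
-- case the arc can only be used in paths ending in S, in the second case only in paths starting in S. Reversing
-- the arcs of the second kind and directing all edges between T and S towards S gives a digraph with the same
-- stable sets, so by Gallai and Milgram it has a partition into |S| paths, each ending in S. Such a path is a BE-path
-- of D or its reverse unless the two kinds of arcs meet at one of its vertices; this requires an arc u → v of both
-- kinds, and then interchanging the tails of two paths reduces the number of such arcs.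
module Submission where

open import Defs
open import Relation.Nullary using (¬_)

open import Data.Bool.Base using (if_then_else_; true; false)
open import Data.Empty using (⊥; ⊥-elim)
open import Data.Fin.Base using (Fin; zero; suc)
import Data.Fin.Properties as Fin
open import Data.Fin.Subset using (Subset; ∣_∣) renaming (_∈_ to _∈ₛ_)
open import Data.Fin.Subset.Properties using () renaming (_∈?_ to _∈ₛ?_)
open import Data.List.Base
  using (List; []; _∷_; _++_; _∷ʳ_; map; concat; length; filter; reverse; _∷ʳ′_; initLast; allFin; tabulate)
import Data.List.Membership.DecPropositional as DecMembership
open import Data.List.Membership.Propositional using (_∈_; _∉_; lose; find)
open import Data.List.Membership.Propositional.Properties using (∈-++⁻; ∈-++⁺ʳ; ∈-++⁺ˡ; ∈-∃++)
open import Data.List.Properties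
  using (++-assoc; length-map; ∷-injective; unfold-reverse; reverse-++; length-++; filter-++; filter-reject; filter-all)
open import Data.List.Relation.Binary.Permutation.Propositional
  using (_↭_; ↭-refl; ↭-sym; ↭-trans; ↭-reflexive; prep; swap; ↭⇒↭ₛ)
open import Data.List.Relation.Binary.Permutation.Propositional.Properties
  using (∈-resp-↭; All-resp-↭; ↭-length; ++⁺ˡ; ++⁺ʳ; ++-comm; shift; shifts; drop-∷; ↭-map-inv; map⁺; ↭-reverse; filter-↭; ∷↭∷ʳ)
open import Data.List.Relation.Unary.All as All using (All; []; _∷_)
import Data.List.Relation.Unary.All.Properties as All
open import Data.List.Relation.Unary.AllPairs as AllPairs using (AllPairs; []; _∷_)
import Data.List.Relation.Unary.AllPairs.Properties as AllPairs
open import Data.List.Relation.Unary.Any as Any using (Any; here; there; any?)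
open import Data.List.Relation.Unary.Linked as Linked using ([]; [-]; _∷_) renaming (Linked to Chain)
open import Data.List.Relation.Unary.Unique.Propositional using (Unique)
open import Data.List.Relation.Unary.Unique.Propositional.Properties using (allFin⁺)
open import Data.Nat.Base using (ℕ; zero; suc; _≤_; _<_; s≤s; z≤n; _+_)
open import Data.Nat.Properties
  using (≤-refl; ≤-trans; ≤-reflexive; ≤-pred; m≤n⇒m≤1+n; +-assoc; +-identityʳ; +-suc; n≮n; m≤n+m; m≤m+n; module ≤-Reasoning)
open import Data.Nat.Tactic.RingSolver using (solve-∀)
open import Data.Product.Base using (Σ; ∃; ∃₂; _×_; _,_; proj₁; proj₂)
open import Data.Sum.Base as Sum using (_⊎_; inj₁; inj₂)
import Data.Vec.Base as Vec
import Data.Vec.Properties as Vec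
open import Function.Base using (_∘_; id; flip; case_of_)
open import Function.Bundles using (mk⇔)
open import Function.Definitions using (Injective)
open import Level using (0ℓ)
open import Relation.Binary.Core using (Rel)
open import Relation.Binary.Definitions using (Decidable; DecidableEquality)
open import Relation.Binary.PropositionalEquality
  using (_≡_; _≢_; refl; sym; trans; cong; cong₂; subst; subst₂; setoid; module ≡-Reasoning)
open import Relation.Nullary using (Dec; yes; no; contradiction)
open import Relation.Nullary.Decidable
  using (_×-dec_; _⊎-dec_; _→-dec_; ¬?; does; map′; dec-true; dec-false; does-⇔)

-- The two kinds of arcs come from one configuration: if `s → v ← u → s′` with `s`, `s′` distinct in
-- S, then the anti-P₄ condition forces `s′ → s`, against stability. The reductions supply the
-- vertices for further such configurations: once they fail, an arc `u → v` inside T has a second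
-- arc `u → x` and a second arc `y → v`, and then `x → y`. An arc of both kinds has to be given one
-- direction, and the choice matters: it is decided by whether the other in-neighbours of `v`
-- receive no arc from S, or the other out-neighbours of `u` send none to S. With this choice, if a
-- path turns at `u` between a reversed `u → x` and a kept `u → v`, then `y` can take over the tail
-- from `v`; since `y → s` with `s` in S implies `s → u`, in return `u` can take over an S-vertex
-- after `y`. Two obstacles remain: the successor of `y` may lie outside S, and `y` may follow `v`
-- on the same path, where the exchange would close a cycle. Apart from the bound on the number of
-- paths, maximality of S is used in two forms: each vertex of T has a neighbour in S, and two
-- nonadjacent ones have a neighbour in S other than any prescribed vertex.

-- Lists, permutations and chains

module Lists where
  private variable
    A : Set
    x y : A
    xs ys zs : List A

  ∈⇒↭ : x ∈ xs → ∃ λ ys → xs ↭ x ∷ ys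
  ∈⇒↭ i with ps , qs , refl ← ∈-∃++ i = ps ++ qs , shift _ ps qs

  concat-↭ : {xss yss : List (List A)} → xss ↭ yss → concat xss ↭ concat yss
  concat-↭ _↭_.refl = ↭-refl
  concat-↭ (prep xs p) = ++⁺ˡ xs (concat-↭ p)
  concat-↭ (swap xs ys p) = ↭-trans (shifts xs ys) (++⁺ˡ ys (++⁺ˡ xs (concat-↭ p)))
  concat-↭ (_↭_.trans p q) = ↭-trans (concat-↭ p) (concat-↭ q)

  -- xs is the list of some of the entries of ys, taken with multiplicity.
  infix 4 _⊑_
  _⊑_ : List A → List A → Set
  xs ⊑ ys = ∃ λ zs → xs ++ zs ↭ ys

  ⊑-resp-↭ : xs ⊑ ys → ys ↭ zs → xs ⊑ zs
  ⊑-resp-↭ (ws , p) q = ws , ↭-trans p q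

  ⊑-there : xs ⊑ ys → xs ⊑ x ∷ ys
  ⊑-there {xs = xs} {x = x} (ws , p) = x ∷ ws , ↭-trans (shift x xs ws) (prep x p)

  ⊑-∈ : xs ⊑ ys → x ∈ xs → x ∈ ys
  ⊑-∈ (_ , p) i = ∈-resp-↭ p (∈-++⁺ˡ i)

  module _ {R : Rel A 0ℓ} where

    chain-++⁻ˡ : ∀ xs → Chain R (xs ++ ys) → Chain R xs
    chain-++⁻ˡ [] c = []
    chain-++⁻ˡ (x ∷ []) c = [-]
    chain-++⁻ˡ (x ∷ y ∷ xs) (r ∷ c) = r ∷ chain-++⁻ˡ (y ∷ xs) c

    chain-++⁻ʳ : ∀ xs → Chain R (xs ++ ys) → Chain R ys
    chain-++⁻ʳ [] c = c
    chain-++⁻ʳ {ys = []} (x ∷ []) c = []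
    chain-++⁻ʳ {ys = y ∷ ys} (x ∷ []) (r ∷ c) = c
    chain-++⁻ʳ (x ∷ y ∷ xs) (r ∷ c) = chain-++⁻ʳ (y ∷ xs) c

    chain-link : ∀ xs → Chain R (xs ++ x ∷ y ∷ ys) → R x y
    chain-link xs c with r ∷ _ ← chain-++⁻ʳ xs c = r

    chain-join : ∀ xs → Chain R (xs ∷ʳ x) → R x y → Chain R (y ∷ ys) → Chain R (xs ++ x ∷ y ∷ ys)
    chain-join [] c r d = r ∷ d
    chain-join (w ∷ []) (q ∷ c) r d = q ∷ r ∷ d
    chain-join (w ∷ v ∷ xs) (q ∷ c) r d = q ∷ chain-join (v ∷ xs) c r d

  chain-reverse : {R : Rel A 0ℓ} → Chain R xs → Chain (flip R) (reverse xs)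
  chain-reverse {xs = []} c = []
  chain-reverse {xs = x ∷ []} c = [-]
  chain-reverse {xs = x ∷ y ∷ xs} {R} (r ∷ c) =
    subst (Chain (flip R)) (sym eq)
      (chain-join (reverse xs) (subst (Chain (flip R)) (unfold-reverse y xs) (chain-reverse c)) r [-])
    where
    eq : reverse (x ∷ y ∷ xs) ≡ reverse xs ++ y ∷ x ∷ []
    eq = trans (unfold-reverse x (y ∷ xs))
      (trans (cong (_∷ʳ x) (unfold-reverse y xs)) (++-assoc (reverse xs) (y ∷ []) (x ∷ [])))

  unique-resp-↭ : xs ↭ ys → Unique xs → Unique ys
  unique-resp-↭ e = Unique-resp-↭ (↭⇒↭ₛ e)
    where open import Data.List.Relation.Binary.Permutation.Setoid.Properties (setoid _)

  unique⇒∉ : Unique (x ∷ xs) → x ∉ xs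
  unique⇒∉ (x≢ ∷ _) i = All.lookup x≢ i refl

  chain-prefix : {R : Rel A 0ℓ} → ∀ xs → Chain R (xs ++ x ∷ ys) → Chain R (xs ∷ʳ x)
  chain-prefix {ys = ys} xs c = chain-++⁻ˡ _ (subst (Chain _) (sym (++-assoc xs (_ ∷ []) ys)) c)

  split-unique : ∀ xs xs′ {x : A} {ys ys′} → Unique (xs ++ x ∷ ys) →
    xs ++ x ∷ ys ≡ xs′ ++ x ∷ ys′ → ys ≡ ys′
  split-unique [] [] u refl = refl
  split-unique [] (_ ∷ xs′) u refl = contradiction (∈-++⁺ʳ xs′ (here refl)) (unique⇒∉ u)
  split-unique (_ ∷ xs) [] u refl = contradiction (∈-++⁺ʳ xs (here refl)) (unique⇒∉ u)
  split-unique (_ ∷ xs) (_ ∷ xs′) (_ ∷ u) e = split-unique xs xs′ u (proj₂ (∷-injective e))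

  unique-disjoint : ∀ xs {ys} {x : A} → Unique (xs ++ ys) → x ∈ xs → x ∉ ys
  unique-disjoint (x ∷ xs) u (here refl) j = unique⇒∉ u (∈-++⁺ʳ xs j)
  unique-disjoint (x ∷ xs) (_ ∷ u) (there i) j = unique-disjoint xs u i j

  successor-unique : ∀ {xs} P P′ {x y z : A} {Q Q′} → Unique xs →
    xs ≡ P ++ x ∷ y ∷ Q → xs ≡ P′ ++ x ∷ z ∷ Q′ → y ≡ z
  successor-unique P P′ u refl e = proj₁ (∷-injective (split-unique P P′ u e))

  unique-++⁻ʳ : ∀ xs {ys : List A} → Unique (xs ++ ys) → Unique ys
  unique-++⁻ʳ [] u = u
  unique-++⁻ʳ (_ ∷ xs) (_ ∷ u) = unique-++⁻ʳ xs u

  swap-blocks : ∀ (ps : List A) a qs b rs → ps ++ a ∷ qs ++ b ∷ rs ↭ qs ++ b ∷ ps ++ a ∷ rs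
  swap-blocks ps a qs b rs = ↭-trans (↭-reflexive (eq ps a qs b))
    (↭-trans (shifts (ps ∷ʳ a) (qs ∷ʳ b)) (↭-reflexive (sym (eq qs b ps a))))
    where
    eq : ∀ ps a qs b → ps ++ a ∷ qs ++ b ∷ rs ≡ (ps ∷ʳ a) ++ (qs ∷ʳ b) ++ rs
    eq ps a qs b = trans (cong (λ l → ps ++ a ∷ l) (sym (++-assoc qs (b ∷ []) rs)))
      (sym (++-assoc ps (a ∷ []) _))

  snoc : ∀ (a : A) as → ∃₂ λ bs b → a ∷ as ≡ bs ∷ʳ b
  snoc a [] = [] , a , refl
  snoc a (a′ ∷ as) with bs , b , eq ← snoc a′ as = a ∷ bs , b , cong (a ∷_) eq

  shift₂ : ∀ xs (a b : A) ys → xs ++ a ∷ b ∷ ys ↭ b ∷ xs ++ a ∷ ys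
  shift₂ xs a b ys = ↭-trans (++⁺ˡ xs (swap a b ↭-refl)) (shift b xs (a ∷ ys))

  filter-⊑ : {P : A → Set} (P? : ∀ a → Dec (P a)) → ∀ xs → filter P? xs ⊑ xs
  filter-⊑ P? [] = [] , ↭-refl
  filter-⊑ P? (x ∷ xs) with P? x | filter-⊑ P? xs
  ... | yes _ | ws , e = ws , prep x e
  ... | no _ | ws , e = x ∷ ws , ↭-trans (shift x _ ws) (prep x e)

  pick₂ : x ∈ xs → y ∈ xs → x ≢ y → ∃ λ ys → xs ↭ x ∷ y ∷ ys
  pick₂ {x = x} i j x≢y with ys , e ← ∈⇒↭ i with ∈-resp-↭ e j
  ... | here refl = contradiction refl x≢y
  ... | there k with zs , e′ ← ∈⇒↭ k = zs , ↭-trans e (prep x e′)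

  allPairs-map-All : {R Q : A → A → Set} {P : A → Set} → (∀ {a b} → P a → P b → R a b → Q a b) →
    All P xs → AllPairs R xs → AllPairs Q xs
  allPairs-map-All f [] [] = []
  allPairs-map-All f (p ∷ ps) (r ∷ rs) = All.zipWith (λ (q , s) → f p q s) (ps , r) ∷ allPairs-map-All f ps rs

  allPairs-lookup : {R : A → A → Set} → (∀ {a b} → R a b → R b a) → AllPairs R xs →
    x ∈ xs → y ∈ xs → x ≡ y ⊎ R x y
  allPairs-lookup sy (r ∷ rs) (here refl) (here refl) = inj₁ refl
  allPairs-lookup sy (r ∷ rs) (here refl) (there j) = inj₂ (All.lookup r j)
  allPairs-lookup sy (r ∷ rs) (there i) (here refl) = inj₂ (sy (All.lookup r i))
  allPairs-lookup sy (r ∷ rs) (there i) (there j) = allPairs-lookup sy rs i j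

  search₂ : {Q : A → A → Set} → (∀ a b → Dec (Q a b)) → ∀ xs →
    (∃₂ λ a b → a ∈ xs × b ∈ xs × Q a b) ⊎ (∀ {a b} → a ∈ xs → b ∈ xs → ¬ Q a b)
  search₂ Q? xs with any? (λ a → any? (Q? a) xs) xs
  ... | yes i with a , a∈ , j ← find i with b , b∈ , q ← find j = inj₁ (a , b , a∈ , b∈ , q)
  ... | no ¬i = inj₂ (λ a∈ b∈ q → ¬i (lose a∈ (lose b∈ q)))

  module _ {P : A → Set} (P? : ∀ a → Dec (P a)) (_≟_ : DecidableEquality A) (m : A) where

    others? : ∀ a → Dec (P a × a ≢ m)
    others? a = P? a ×-dec ¬? (a ≟ m)

    filter-others : m ∉ xs → length (filter P? xs) ≤ length (filter others? xs)
    filter-others {[]} m∉ = z≤n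
    filter-others {x ∷ xs} m∉ with P? x | x ≟ m
    ... | no _ | _ = filter-others (m∉ ∘ there)
    ... | yes _ | no _ = s≤s (filter-others (m∉ ∘ there))
    ... | yes _ | yes refl = contradiction (here refl) m∉

    filter-unique : Unique xs → length (filter P? xs) ≤ suc (length (filter others? xs))
    filter-unique [] = z≤n
    filter-unique {x ∷ xs} u@(_ ∷ us) with P? x | x ≟ m
    ... | no _ | _ = filter-unique us
    ... | yes _ | no _ = s≤s (filter-unique us)
    ... | yes _ | yes refl = s≤s (filter-others (unique⇒∉ u))

open Lists

-- The Gallai-Milgram theorem

module GallaiMilgram {V : Set} {_⟶_ : Rel V 0ℓ} (_⟶?_ : Decidable _⟶_) where

  Path : Set
  Path = V × List V

  vertices : Path → List V
  vertices (h , t) = h ∷ t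

  cover : List Path → List V
  cover ps = concat (map vertices ps)

  IsPath : Path → Set
  IsPath p = Chain _⟶_ (vertices p)

  Free : V → V → Set
  Free a b = ¬ (a ⟶ b) × ¬ (b ⟶ a)

  cover-↭ : ∀ {ps qs} → ps ↭ qs → cover ps ↭ cover qs
  cover-↭ p = concat-↭ (map⁺ vertices p)

  free-or-arc : ∀ ps → AllPairs Free (map proj₁ ps)
    ⊎ Σ Path λ p → Σ Path λ q → ∃ λ qs → ps ↭ p ∷ q ∷ qs × proj₁ p ⟶ proj₁ q
  free-or-arc [] = inj₁ []
  free-or-arc (p ∷ ps)
    with any? (λ q → (proj₁ p ⟶? proj₁ q) ⊎-dec (proj₁ q ⟶? proj₁ p)) ps
  ... | yes i with find i
  ...   | q , q∈ , inj₁ r with qs , e ← ∈⇒↭ q∈ = inj₂ (p , q , qs , prep p e , r)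
  ...   | q , q∈ , inj₂ r with qs , e ← ∈⇒↭ q∈ =
          inj₂ (q , p , qs , ↭-trans (prep p e) (swap p q ↭-refl) , r)
  free-or-arc (p ∷ ps) | no ¬i with free-or-arc ps
  ... | inj₁ f = inj₁ (All.map⁺ (All.map (λ ¬r → ¬r ∘ inj₁ , ¬r ∘ inj₂) (All.¬Any⇒All¬ ps ¬i)) ∷ f)
  ... | inj₂ (q , q′ , qs , e , r) =
        inj₂ (q , q′ , p ∷ qs , ↭-trans (prep p e) (↭-trans (swap p q ↭-refl) (prep q (swap p q′ ↭-refl))) , r)

  private
    -- Here `a` is the new head of a shortened path and `b` the head that the removed vertex also
    -- reaches. Only one head disappears, so `a` or `b` survives, and the removed vertex can be put
    -- back in front of it; `h′` is the head that the original system loses.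
    remaining-head : ∀ {a b h} {H K : List V} → a ∷ b ∷ H ↭ h ∷ K →
      ∃ λ x → (x ≡ a ⊎ x ≡ b) × ∃ λ K′ → K ↭ x ∷ K′ × ∃ λ h′ → b ∷ H ↭ h′ ∷ K′
    remaining-head {a} {b} {h} {H} {K} e with ∈-resp-↭ (↭-sym e) (here refl)
    ... | here refl = b , inj₂ refl , H , ↭-sym (drop-∷ e) , b , ↭-refl
    ... | there (here refl) =
          a , inj₁ refl , H , ↭-sym (drop-∷ (↭-trans (swap b a ↭-refl) e)) , b , ↭-refl
    ... | there (there i) with H′ , e′ ← ∈⇒↭ i =
          a , inj₁ refl , b ∷ H′
          , ↭-sym (drop-∷ (↭-trans (swap h a ↭-refl) (↭-trans (prep a (swap h b ↭-refl)) (↭-trans (prep a (prep b (↭-sym e′))) e))))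
          , h , ↭-trans (prep b e′) (swap b h ↭-refl)

  -- Heads rather than numbers of paths are tracked: when the path of a head h with an arc to another
  -- head is shortened to its tail, an improvement of the shortened system frees a head that h precedes.
  improve : ∀ n ps → length (cover ps) ≤ n → All IsPath ps →
    (∃ λ A → AllPairs Free A × A ⊑ cover ps × length A ≡ length ps)
    ⊎ ∃ λ qs → All IsPath qs × cover qs ↭ cover ps × ∃ λ h → map proj₁ ps ↭ h ∷ map proj₁ qs
  improve n ps le ok with free-or-arc ps
  ... | inj₁ f = inj₁ (map proj₁ ps , f , heads⊑ ps , length-map proj₁ ps)
    where
    heads⊑ : ∀ ps → map proj₁ ps ⊑ cover ps
    heads⊑ [] = [] , ↭-refl
    heads⊑ ((h , t) ∷ ps) with ws , e ← heads⊑ ps =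
      t ++ ws , prep h (↭-trans (shifts (map proj₁ ps) t) (++⁺ˡ t e))
  ... | inj₂ ((h , []) , (k , t) , qs , e , r) with _ ∷ c ∷ cs ← All-resp-↭ e ok =
        inj₂ ((h , k ∷ t) ∷ qs , (r ∷ c) ∷ cs , cover-↭ (↭-sym e)
             , k , ↭-trans (map⁺ proj₁ e) (swap h k ↭-refl))
  improve zero ps le ok | inj₂ ((h , x ∷ s) , (k , t) , qs , e , r)
    with () ← subst (_≤ 0) (↭-length (cover-↭ e)) le
  improve (suc n) ps le ok | inj₂ ((h , x ∷ s) , (k , t) , qs , e , r)
    with (rₓ ∷ c₁) ∷ c₂ ∷ cs ← All-resp-↭ e ok
    with improve n ((x , s) ∷ (k , t) ∷ qs) (≤-pred (subst (_≤ suc n) (↭-length (cover-↭ e)) le)) (c₁ ∷ c₂ ∷ cs)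
  ... | inj₁ (A , f , A⊑ , len) =
        inj₁ (A , f , ⊑-resp-↭ (⊑-there A⊑) (cover-↭ (↭-sym e)) , trans len (sym (↭-length e)))
  ... | inj₂ (ps′ , ok′ , cov , h₁ , e₁)
    with x′ , x′≡ , K , e₂ , h₂ , e₃ ← remaining-head e₁
    with (y , t′) ∷ ps″ , refl , e₄ ← ↭-map-inv proj₁ e₂
    with c ∷ cs′ ← All-resp-↭ e₄ ok′ =
      inj₂ ((h , y ∷ t′) ∷ ps″ , (h⟶y x′≡ ∷ c) ∷ cs′
           , ↭-trans (prep h (↭-trans (cover-↭ (↭-sym e₄)) cov)) (cover-↭ (↭-sym e))
           , h₂ , ↭-trans (map⁺ proj₁ e) (↭-trans (prep h e₃) (swap h h₂ ↭-refl)))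
    where
    h⟶y : y ≡ x ⊎ y ≡ k → h ⟶ y
    h⟶y (inj₁ refl) = rₓ
    h⟶y (inj₂ refl) = r

  -- Starting from one-vertex paths, each improvement keeps the covered vertices and costs one head,
  -- so it must stop at a stable set with as many vertices as there are paths.
  gallai-milgram : ∀ k W → (∀ A → AllPairs Free A → A ⊑ W → length A ≤ k) →
    ∃ λ ps → All IsPath ps × cover ps ↭ W × length ps ≤ k
  gallai-milgram k W α≤k = shrink (length W) (map (_, []) W) (trivial W) (≤-reflexive (length-map _ W)) (cover-trivial W)
    where
    trivial : ∀ W → All IsPath (map (_, []) W)
    trivial [] = []
    trivial (w ∷ W) = [-] ∷ trivial W

    cover-trivial : ∀ W → cover (map (_, []) W) ↭ W
    cover-trivial [] = ↭-refl
    cover-trivial (w ∷ W) = prep w (cover-trivial W)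

    shrink : ∀ n ps → All IsPath ps → length ps ≤ n → cover ps ↭ W →
      ∃ λ ps → All IsPath ps × cover ps ↭ W × length ps ≤ k
    shrink n ps ok le cov with improve (length (cover ps)) ps ≤-refl ok
    ... | inj₁ (A , f , A⊑ , len) =
          ps , ok , cov , subst (_≤ k) len (α≤k A f (⊑-resp-↭ A⊑ cov))
    shrink zero ps ok le cov | inj₂ (qs , _ , _ , h , e)
      with () ← subst (_≤ 0) (trans (sym (length-map proj₁ ps)) (↭-length e)) le
    shrink (suc n) ps ok le cov | inj₂ (qs , ok′ , cov′ , h , e) =
      shrink n qs ok′ (≤-pred (subst (_≤ suc n) len le)) (↭-trans cov′ cov)
      where
      len : length ps ≡ suc (length qs)
      len = trans (sym (length-map proj₁ ps)) (trans (↭-length e) (cong suc (length-map proj₁ qs)))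

-- Digraphs with a stable set, and their BE-paths

module SPaths {V : Set} (_⇾_ : Rel V 0ℓ) (S : V → Set) where

  data SPath : List V → Set where
    begins : ∀ {s ts} → S s → All (λ t → ¬ S t) ts → Chain _⇾_ (s ∷ ts) → SPath (s ∷ ts)
    ends : ∀ {s ts} → S s → All (λ t → ¬ S t) ts → Chain _⇾_ (ts ∷ʳ s) → SPath (ts ∷ʳ s)

  SPartition : List V → Set
  SPartition W = ∃ λ Ps → All SPath Ps × concat Ps ↭ W

-- Arcs live on all of `V`, and a separate list `W` tells which vertices are present, so a deletion
-- changes only `W`. `anti` leaves out the inequalities that follow from the arcs; `tri` forbids the
-- blocking triangle with source `a` and sink `b`.
record Setting (V : Set) : Set₁ where
  infix 4 _⇾_ _≟_ _⇾?_
  field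
    _≟_ : DecidableEquality V
    _⇾_ : Rel V 0ℓ
    _⇾?_ : Decidable _⇾_
    irrefl : ∀ {a} → ¬ a ⇾ a
    anti : ∀ {a b c d} → a ⇾ b → c ⇾ b → c ⇾ d → a ≢ c → b ≢ d → a ≢ d → d ⇾ a
    tri : ∀ {a b c} → a ⇾ b → a ⇾ c → c ⇾ b → b ⇾ a ⊎ c ⇾ a ⊎ b ⇾ c
    S : V → Set
    S? : ∀ a → Dec (S a)
    stable : ∀ {a b} → S a → S b → ¬ a ⇾ b

-- Reversal keeps the hypotheses: the pattern of `anti` is read from the other end, and source and
-- sink of `tri` change places. Most arguments are therefore given in one of their two mirror forms.
op : {V : Set} → Setting V → Setting V
op 𝕊 = record
  { _≟_ = _≟_
  ; _⇾_ = flip _⇾_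
  ; _⇾?_ = flip _⇾?_
  ; irrefl = irrefl
  ; anti = λ b⇾a b⇾c d⇾c a≢c b≢d a≢d → anti d⇾c b⇾c b⇾a (b≢d ∘ sym) (a≢c ∘ sym) (a≢d ∘ sym)
  ; tri = λ b⇾a c⇾a b⇾c → case tri b⇾a b⇾c c⇾a of λ
      { (inj₁ r) → inj₁ r ; (inj₂ (inj₁ r)) → inj₂ (inj₂ r) ; (inj₂ (inj₂ r)) → inj₂ (inj₁ r) }
  ; S = S
  ; S? = S?
  ; stable = flip stable
  }
  where open Setting 𝕊

module Paths {V : Set} (𝕊 : Setting V) where
  open Setting 𝕊 public

  T : V → Set
  T a = ¬ S a

  Adj : V → V → Set
  Adj a b = a ⇾ b ⊎ b ⇾ a

  open SPaths _⇾_ S public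

  ⇾⇒≢ : ∀ {a b} → a ⇾ b → a ≢ b
  ⇾⇒≢ r refl = irrefl r

  ST⇒≢ : ∀ {a b} → S a → T b → a ≢ b
  ST⇒≢ s t refl = t s

  TS⇒≢ : ∀ {a b} → T a → S b → a ≢ b
  TS⇒≢ t s refl = t s

  head-or-pred : ∀ {v p ps} → Chain _⇾_ (p ∷ ps) → v ∈ p ∷ ps → v ≡ p ⊎ ∃ λ q → q ∈ p ∷ ps × q ⇾ v
  head-or-pred c (here e) = inj₁ e
  head-or-pred (r ∷ c) (there i) with head-or-pred c i
  ... | inj₁ refl = inj₂ (_ , here refl , r)
  ... | inj₂ (q , j , r′) = inj₂ (q , there j , r′)

  locate : ∀ {W v} → SPartition W → v ∈ W →
    ∃₂ λ P Qs → v ∈ P × SPath P × All SPath Qs × P ++ concat Qs ↭ W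
  locate {W} {v} (Ps , ok , e) v∈ = go Ps ok e (∈-resp-↭ (↭-sym e) v∈)
    where
    go : ∀ Ps {W} → All SPath Ps → concat Ps ↭ W → v ∈ concat Ps →
      ∃₂ λ P Qs → v ∈ P × SPath P × All SPath Qs × P ++ concat Qs ↭ W
    go (P ∷ Ps) (ok ∷ oks) e i with ∈-++⁻ P i
    ... | inj₁ j = P , Ps , j , ok , oks , e
    ... | inj₂ j with Q , Qs , k , okQ , okQs , e′ ← go Ps oks ↭-refl j =
          Q , P ∷ Qs , k , okQ , ok ∷ okQs , ↭-trans (shifts Q P) (↭-trans (++⁺ˡ P e′) e)

  reinsert : ∀ {W W′ P P′ Qs} us → SPath P′ → P′ ↭ us ++ P → All SPath Qs →
    P ++ concat Qs ↭ W′ → W ↭ us ++ W′ → SPartition W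
  reinsert {P = P} {P′} {Qs} us ok e oks e′ e″ = P′ ∷ Qs , ok ∷ oks ,
    ↭-trans (++⁺ʳ (concat Qs) e)
      (↭-trans (↭-reflexive (++-assoc us P (concat Qs))) (↭-trans (++⁺ˡ us e′) (↭-sym e″)))

module _ {V : Set} {_⇾_ : Rel V 0ℓ} {S : V → Set} where
  open SPaths _⇾_ S
  private module Op = SPaths (flip _⇾_) S

  path-op : ∀ {P} → SPath P → Op.SPath (reverse P)
  path-op (begins {s} {ts} Ss Ts c) =
    subst (Op.SPath) (sym (unfold-reverse s ts))
      (Op.ends Ss (All-resp-↭ (↭-sym (↭-reverse ts)) Ts)
        (subst (Chain _) (unfold-reverse s ts) (chain-reverse c)))
  path-op (ends {s} {ts} Ss Ts c) =
    subst (Op.SPath) (sym (reverse-++ ts (s ∷ [])))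
      (Op.begins Ss (All-resp-↭ (↭-sym (↭-reverse ts)) Ts)
        (subst (Chain _) (reverse-++ ts (s ∷ [])) (chain-reverse c)))

  partition-op : ∀ {W} → SPartition W → Op.SPartition W
  partition-op (Ps , ok , e) = map reverse Ps , paths ok , ↭-trans (cover Ps) e
    where
    paths : ∀ {Ps} → All SPath Ps → All (Op.SPath) (map reverse Ps)
    paths [] = []
    paths (p ∷ ps) = path-op p ∷ paths ps

    cover : ∀ Ps → concat (map reverse Ps) ↭ concat Ps
    cover [] = ↭-refl
    cover (P ∷ Ps) = ↭-trans (++⁺ʳ _ (↭-reverse P)) (++⁺ˡ P (cover Ps))

-- Reductions: deleting one or two vertices outside S

module Reductions {V : Set} (𝕊 : Setting V) (W : List V) (uniq : Unique W)
  (ih : ∀ u us {W′} → W ↭ u ∷ us ++ W′ → All (Paths.T 𝕊) (u ∷ us) → Paths.SPartition 𝕊 W′) where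

  open Paths 𝕊

  private
    all⇒ : ∀ {P : List V} {Q R} → P ++ Q ↭ R → All (_∈ R) P
    all⇒ e = All.tabulate (λ i → ∈-resp-↭ e (∈-++⁺ˡ i))

  -- Without `u` nothing enters `v`, so `v` is the first vertex of its path. As `v` is not in S,
  -- that path ends in S, and `u` can be put in front.
  star : ∀ {u v} → u ∈ W → v ∈ W → T u → T v → u ⇾ v → (∀ {y} → y ∈ W → y ⇾ v → y ≡ u) → SPartition W
  star {u} {v} u∈ v∈ Tu Tv u⇾v only with W′ , e ← ∈⇒↭ u∈ = go
    where
    u∉W′ : u ∉ W′
    u∉W′ = unique⇒∉ (unique-resp-↭ e uniq)

    v∈W′ : v ∈ W′
    v∈W′ with ∈-resp-↭ e v∈
    ... | here eq = contradiction (sym eq) (⇾⇒≢ u⇾v)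
    ... | there i = i

    no-pred : ∀ {y} → y ∈ W′ → ¬ y ⇾ v
    no-pred y∈ r = u∉W′ (subst (_∈ W′) (only (∈-resp-↭ (↭-sym e) (there y∈)) r) y∈)

    go : SPartition W
    go with locate (ih u [] e (Tu ∷ [])) v∈W′
    ... | _ , Qs , i , begins Ss Ts c , oks , e′ with head-or-pred c i
    ...   | inj₁ refl = contradiction Ss Tv
    ...   | inj₂ (q , j , r) = contradiction r (no-pred (All.lookup (all⇒ e′) j))
    go | _ , Qs , i , ends {ts = []} Ss Ts c , oks , e′ with here refl ← i = contradiction Ss Tv
    go | _ , Qs , i , ends {s} {t ∷ ts} Ss Ts c , oks , e′ with head-or-pred c i
    ...   | inj₂ (q , j , r) = contradiction r (no-pred (All.lookup (all⇒ e′) j))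
    ...   | inj₁ refl = reinsert (u ∷ []) (ends {ts = u ∷ t ∷ ts} Ss (Tu ∷ Ts) (u⇾v ∷ c)) ↭-refl oks e′ e

  record Irreducible : Set where
    field
      out : ∀ {u v} → u ∈ W → v ∈ W → T u → T v → u ⇾ v → ∃ λ x → x ∈ W × x ≢ v × u ⇾ x
      inn : ∀ {u v} → u ∈ W → v ∈ W → T u → T v → u ⇾ v → ∃ λ y → y ∈ W × y ≢ u × y ⇾ v

  module _ (dominated : ∀ {t} → t ∈ W → T t → ∃ λ σ → σ ∈ W × S σ × Adj σ t) (irr : Irreducible) where
    open Irreducible irr

    private
      module Delete {u v W′} (Tu : T u) (Tv : T v) (u⇾v : u ⇾ v) (e : W ↭ u ∷ v ∷ W′) where
        uniq′ : Unique (u ∷ v ∷ W′)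
        uniq′ = unique-resp-↭ e uniq

        ≢u : ∀ {a} → a ∈ W′ → a ≢ u
        ≢u i refl = unique⇒∉ uniq′ (there i)

        ≢v : ∀ {a} → a ∈ W′ → a ≢ v
        ≢v i refl = unique⇒∉ (AllPairs.tail uniq′) i

        ∈W : ∀ {a} → a ∈ W′ → a ∈ W
        ∈W i = ∈-resp-↭ (↭-sym e) (there (there i))

        ∈W′ : ∀ {a} → a ∈ W → a ≢ u → a ≢ v → a ∈ W′
        ∈W′ i a≢u a≢v with ∈-resp-↭ e i
        ... | here refl = contradiction refl a≢u
        ... | there (here refl) = contradiction refl a≢v
        ... | there (there j) = j

        u∈ : u ∈ W
        u∈ = ∈-resp-↭ (↭-sym e) (here refl)

        v∈ : v ∈ W
        v∈ = ∈-resp-↭ (↭-sym e) (there (here refl))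

        parts : SPartition W′
        parts = ih u (v ∷ []) e (Tu ∷ Tv ∷ [])

    -- By the anti-P₄ condition an arc into the digon is passed on to the next vertex of a path, and
    -- an arc out of it to the previous one, the end of the digon changing each time. So the digon
    -- fits behind a path that starts in S and sends an arc to it, and in front of a path that ends
    -- in S and receives one.
    module Digon {u v W′} (Tu : T u) (Tv : T v) (u⇾v : u ⇾ v) (v⇾u : v ⇾ u) (e : W ↭ u ∷ v ∷ W′) where
      open Delete Tu Tv u⇾v e

      Into OutOf : V → Set
      Into a = a ⇾ u ⊎ a ⇾ v
      OutOf b = u ⇾ b ⊎ v ⇾ b

      into-closed : ∀ {a c} → a ∈ W′ → c ∈ W′ → Into a → a ⇾ c → Into c
      into-closed i j (inj₁ a⇾u) a⇾c = inj₂ (anti v⇾u a⇾u a⇾c (≢v i ∘ sym) (≢u j ∘ sym) (≢v j ∘ sym))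
      into-closed i j (inj₂ a⇾v) a⇾c = inj₁ (anti u⇾v a⇾v a⇾c (≢u i ∘ sym) (≢v j ∘ sym) (≢u j ∘ sym))

      outof-closed : ∀ {b c} → b ∈ W′ → c ∈ W′ → OutOf b → c ⇾ b → OutOf c
      outof-closed i j (inj₁ u⇾b) c⇾b = inj₂ (anti c⇾b u⇾b u⇾v (≢u j) (≢v i) (≢v j))
      outof-closed i j (inj₂ v⇾b) c⇾b = inj₁ (anti c⇾b v⇾b v⇾u (≢v j) (≢u i) (≢u j))

      append : ∀ {p ps} → All (_∈ W′) (p ∷ ps) → Chain _⇾_ (p ∷ ps) → Any Into (p ∷ ps) →
        Chain _⇾_ (p ∷ ps ++ u ∷ v ∷ []) ⊎ Chain _⇾_ (p ∷ ps ++ v ∷ u ∷ [])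
      append {ps = []} _ _ (here (inj₁ p⇾u)) = inj₁ (p⇾u ∷ u⇾v ∷ [-])
      append {ps = []} _ _ (here (inj₂ p⇾v)) = inj₂ (p⇾v ∷ v⇾u ∷ [-])
      append {ps = _ ∷ _} (i ∷ j ∷ is) (r ∷ c) (here Ip) with append (j ∷ is) c (here (into-closed i j Ip r))
      ... | inj₁ d = inj₁ (r ∷ d)
      ... | inj₂ d = inj₂ (r ∷ d)
      append {ps = _ ∷ _} (i ∷ is) (r ∷ c) (there I) with append is c I
      ... | inj₁ d = inj₁ (r ∷ d)
      ... | inj₂ d = inj₂ (r ∷ d)

      head-outof : ∀ {p ps} → All (_∈ W′) (p ∷ ps) → Chain _⇾_ (p ∷ ps) → Any OutOf (p ∷ ps) → OutOf p
      head-outof _ _ (here Op) = Op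
      head-outof (i ∷ j ∷ is) (r ∷ c) (there O) = outof-closed j i (head-outof (j ∷ is) c O) r

      last-into : ∀ ts {s} → All (_∈ W′) (ts ∷ʳ s) → Chain _⇾_ (ts ∷ʳ s) → Any Into (ts ∷ʳ s) → Into s
      last-into [] _ _ (here Is) = Is
      last-into (t ∷ []) (i ∷ j ∷ []) (r ∷ c) (here It) = into-closed i j It r
      last-into (t ∷ t′ ∷ ts) (i ∷ is@(j ∷ _)) (r ∷ c) (here It) = last-into (t′ ∷ ts) is c (here (into-closed i j It r))
      last-into (t ∷ []) (i ∷ is) (r ∷ c) (there I) = last-into [] is c I
      last-into (t ∷ t′ ∷ ts) (i ∷ is) (r ∷ c) (there I) = last-into (t′ ∷ ts) is c I

      module _ {P Qs} (oks : All SPath Qs) (e′ : P ++ concat Qs ↭ W′) where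

        insert-end : ∀ {s ts} → P ≡ s ∷ ts → S s → All T ts → Chain _⇾_ P → Any Into P → SPartition W
        insert-end {s} {ts} refl Ss Ts c I with append (all⇒ e′) c I
        ... | inj₁ d = reinsert (u ∷ v ∷ []) (begins Ss (All.++⁺ Ts (Tu ∷ Tv ∷ [])) d)
                         (++-comm P (u ∷ v ∷ [])) oks e′ e
        ... | inj₂ d = reinsert (u ∷ v ∷ []) (begins Ss (All.++⁺ Ts (Tv ∷ Tu ∷ [])) d)
                         (↭-trans (++-comm P (v ∷ u ∷ [])) (swap v u ↭-refl)) oks e′ e

        insert-start : ∀ {s ts} → P ≡ ts ∷ʳ s → S s → All T ts → Chain _⇾_ P → Any OutOf P → SPartition W
        insert-start {s} {ts} refl Ss Ts c O = go ts Ts (all⇒ e′) c O e′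
          where
          go : ∀ ts → All T ts → All (_∈ W′) (ts ∷ʳ s) → Chain _⇾_ (ts ∷ʳ s) → Any OutOf (ts ∷ʳ s) →
            (ts ∷ʳ s) ++ concat Qs ↭ W′ → SPartition W
          go [] Ts is c O e′ with head-outof is c O
          ... | inj₁ u⇾s = reinsert (u ∷ v ∷ []) (ends Ss (Tv ∷ Tu ∷ []) (v⇾u ∷ u⇾s ∷ c)) (swap v u ↭-refl) oks e′ e
          ... | inj₂ v⇾s = reinsert (u ∷ v ∷ []) (ends Ss (Tu ∷ Tv ∷ []) (u⇾v ∷ v⇾s ∷ c)) ↭-refl oks e′ e
          go (t ∷ ts) Ts is c O e′ with head-outof is c O
          ... | inj₁ u⇾t = reinsert (u ∷ v ∷ []) (ends Ss (Tv ∷ Tu ∷ Ts) (v⇾u ∷ u⇾t ∷ c)) (swap v u ↭-refl) oks e′ e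
          ... | inj₂ v⇾t = reinsert (u ∷ v ∷ []) (ends Ss (Tu ∷ Tv ∷ Ts) (u⇾v ∷ v⇾t ∷ c)) ↭-refl oks e′ e

      -- If the path of `a` starts in S, the digon goes behind it; otherwise the arc into the digon
      -- is passed on to the last vertex of the path, which lies in S.
      S-into : ∀ {a} → a ∈ W′ → Into a → SPartition W ⊎ ∃ λ σ → σ ∈ W′ × S σ × Into σ
      S-into i I with locate parts i
      ... | _ , _ , j , begins Ss Ts c , oks , e′ = inj₁ (insert-end oks e′ refl Ss Ts c (lose j I))
      ... | _ , _ , j , ends {s} {ts} Ss Ts c , oks , e′ =
            inj₂ (s , All.lookup (all⇒ e′) (∈-++⁺ʳ ts (here refl)) , Ss , last-into ts (all⇒ e′) c (lose j I))

      S-outof : ∀ {b} → b ∈ W′ → OutOf b → SPartition W ⊎ ∃ λ σ → σ ∈ W′ × S σ × OutOf σ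
      S-outof i O with locate parts i
      ... | _ , _ , j , ends {s} {ts} Ss Ts c , oks , e′ = inj₁ (insert-start oks e′ refl Ss Ts c (lose j O))
      ... | _ , _ , j , begins Ss Ts c , oks , e′ =
            inj₂ (_ , ∈-resp-↭ e′ (here refl) , Ss , head-outof (all⇒ e′) c (lose j O))

      -- A vertex with arcs in both directions allows the insertion whichever end of its path lies
      -- in S.
      both : ∀ {σ} → σ ∈ W′ → Into σ → OutOf σ → SPartition W
      both i I O with locate parts i
      ... | _ , _ , j , begins Ss Ts c , oks , e′ = insert-end oks e′ refl Ss Ts c (lose j I)
      ... | _ , _ , j , ends Ss Ts c , oks , e′ = insert-start oks e′ refl Ss Ts c (lose j O)

      private
        -- An S-vertex entering u and one leaving the other end of the digon would be joined by an arc.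
        cross : ∀ {a b σ β} → a ⇾ b → T a → T b → σ ∈ W′ → S σ → S β → σ ⇾ b → a ⇾ β →
          Into σ → OutOf β → SPartition W
        cross {σ = σ} {β} a⇾b Ta Tb i Sσ Sβ σ⇾b a⇾β I O with σ ≟ β
        ... | yes refl = both i I O
        ... | no σ≢β = contradiction (anti σ⇾b a⇾b a⇾β (ST⇒≢ Sσ Ta) (TS⇒≢ Tb Sβ) σ≢β) (stable Sβ Sσ)

        resolve : ∀ {σ β} → σ ∈ W′ → S σ → β ∈ W′ → S β → Into σ → OutOf β → SPartition W
        resolve i Sσ j Sβ I@(inj₂ σ⇾v) O@(inj₁ u⇾β) = cross u⇾v Tu Tv i Sσ Sβ σ⇾v u⇾β I O
        resolve i Sσ j Sβ I@(inj₁ σ⇾u) O@(inj₂ v⇾β) = cross v⇾u Tv Tu i Sσ Sβ σ⇾u v⇾β I O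
        -- Both arcs meet the digon at `u`, so a neighbour in S of the other end `v` is taken to
        -- obtain a crossed pair.
        resolve i Sσ j Sβ I@(inj₁ σ⇾u) O@(inj₁ u⇾β) with dominated v∈ Tv
        ... | ω , k , Sω , inj₁ ω⇾v = cross u⇾v Tu Tv (∈W′ k (ST⇒≢ Sω Tu) (ST⇒≢ Sω Tv)) Sω Sβ ω⇾v u⇾β (inj₂ ω⇾v) O
        ... | ω , k , Sω , inj₂ v⇾ω = cross v⇾u Tv Tu i Sσ Sω σ⇾u v⇾ω I (inj₂ v⇾ω)
        resolve i Sσ j Sβ I@(inj₂ σ⇾v) O@(inj₂ v⇾β) with dominated u∈ Tu
        ... | ω , k , Sω , inj₁ ω⇾u = cross v⇾u Tv Tu (∈W′ k (ST⇒≢ Sω Tu) (ST⇒≢ Sω Tv)) Sω Sβ ω⇾u v⇾β (inj₁ ω⇾u) O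
        ... | ω , k , Sω , inj₂ u⇾ω = cross u⇾v Tu Tv i Sσ Sω σ⇾v u⇾ω I (inj₁ u⇾ω)

      solve : SPartition W
      solve with out u∈ v∈ Tu Tv u⇾v | inn v∈ u∈ Tv Tu v⇾u
      ... | b , b∈ , b≢v , u⇾b | a , a∈ , a≢v , a⇾u
        with S-into (∈W′ a∈ (⇾⇒≢ a⇾u) a≢v) (inj₁ a⇾u) | S-outof (∈W′ b∈ (⇾⇒≢ u⇾b ∘ sym) b≢v) (inj₁ u⇾b)
      ... | inj₁ p | _ = p
      ... | inj₂ _ | inj₁ p = p
      ... | inj₂ (_ , i , Sσ , I) | inj₂ (_ , j , Sβ , O) = resolve i Sσ j Sβ I O

    -- This is the passage `u → s → v` with a digon between `s` and `u`; a digon between `s` and `v`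
    -- is the reversed situation.
    module Triangle (no-digon : ∀ {a b} → a ∈ W → b ∈ W → T a → T b → a ⇾ b → ¬ b ⇾ a)
      {u v s W′} (Tu : T u) (Tv : T v) (u⇾v : u ⇾ v) (e : W ↭ u ∷ v ∷ W′)
      (Ss : S s) (s∈ : s ∈ W) (s⇾u : s ⇾ u) (u⇾s : u ⇾ s) (s⇾v : s ⇾ v) where
      open Delete Tu Tv u⇾v e

      private
        no-triangle : ∀ {a b c} → a ∈ W → b ∈ W → c ∈ W → T a → T b → T c → a ⇾ b → a ⇾ c → ¬ c ⇾ b
        no-triangle i j k Ta Tb Tc a⇾b a⇾c c⇾b with tri a⇾b a⇾c c⇾b
        ... | inj₁ b⇾a = no-digon i j Ta Tb a⇾b b⇾a
        ... | inj₂ (inj₁ c⇾a) = no-digon i k Ta Tc a⇾c c⇾a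
        ... | inj₂ (inj₂ b⇾c) = no-digon k j Tc Tb c⇾b b⇾c

        u≢v = ⇾⇒≢ u⇾v
        s≢u = ST⇒≢ Ss Tu
        s≢v = ST⇒≢ Ss Tv

        v⇾pred : ∀ {w} → w ∈ W′ → w ⇾ s → v ⇾ w
        v⇾pred i w⇾s = anti w⇾s u⇾s u⇾v (≢u i) s≢v (≢v i)

        -- A second out-neighbour `f` of `w₁` would form a digon with `u`, hence lie in S, and yet
        -- receive an arc from `s`. So a path ending in `s` has at most one vertex before `s`, and
        -- `v` has an arc to that vertex.
        no-long : ∀ {w₁ w} → w₁ ∈ W′ → w ∈ W′ → T w₁ → T w → w₁ ⇾ w → ¬ w ⇾ s
        no-long {w₁} {w} i j Tw₁ Tw w₁⇾w w⇾s with out (∈W i) (∈W j) Tw₁ Tw w₁⇾w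
        ... | f , f∈ , f≢w , w₁⇾f = contradiction s⇾f (stable Ss Sf)
          where
          v⇾w = v⇾pred j w⇾s

          ¬v⇾w₁ : ¬ v ⇾ w₁
          ¬v⇾w₁ v⇾w₁ = no-triangle v∈ (∈W j) (∈W i) Tv Tw Tw₁ v⇾w v⇾w₁ w₁⇾w

          f≢v : f ≢ v
          f≢v refl = no-triangle (∈W i) (∈W j) v∈ Tw₁ Tw Tv w₁⇾w w₁⇾f v⇾w

          f≢s : f ≢ s
          f≢s refl = ¬v⇾w₁ (v⇾pred i w₁⇾f)

          f≢u : f ≢ u
          f≢u refl = ¬v⇾w₁ (anti w₁⇾f s⇾u s⇾v (TS⇒≢ Tw₁ Ss) u≢v (≢v i))

          f⇾v = anti v⇾w w₁⇾w w₁⇾f (≢v i ∘ sym) (f≢w ∘ sym) (f≢v ∘ sym)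
          u⇾f = anti f⇾v s⇾v s⇾u f≢s (u≢v ∘ sym) f≢u
          s⇾f = anti f⇾v u⇾v u⇾s f≢u (s≢v ∘ sym) f≢s
          f⇾u = anti u⇾v s⇾v s⇾f (s≢u ∘ sym) (f≢v ∘ sym) (f≢u ∘ sym)

          Sf : S f
          Sf with S? f
          ... | yes Sf = Sf
          ... | no Tf = contradiction f⇾u (no-digon u∈ f∈ Tu Tf u⇾f)

        insert : ∀ {s′ Qs} ts → s ∈ s′ ∷ ts → All T ts → Chain _⇾_ (s′ ∷ ts) → All SPath Qs →
          (s′ ∷ ts) ++ concat Qs ↭ W′ → SPartition W
        insert ts (there i) Ts c oks e′ = contradiction Ss (All.lookup Ts i)
        insert [] (here refl) Ts c oks e′ =
          reinsert (u ∷ v ∷ []) (begins Ss (Tu ∷ Tv ∷ []) (s⇾u ∷ u⇾v ∷ [-])) (++-comm (s ∷ []) (u ∷ v ∷ [])) oks e′ e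
        insert (q ∷ ts) (here refl) Ts (s⇾q ∷ c) oks e′ =
          reinsert (u ∷ v ∷ []) (begins Ss (Tu ∷ Tv ∷ Ts) (s⇾u ∷ u⇾v ∷ v⇾q ∷ c)) (shifts (s ∷ []) (u ∷ v ∷ [])) oks e′ e
          where
          i = ∈-resp-↭ e′ (there (here refl))
          q⇾u = anti u⇾v s⇾v s⇾q (s≢u ∘ sym) (≢v i ∘ sym) (≢u i ∘ sym)
          v⇾q = anti q⇾u s⇾u s⇾v (⇾⇒≢ s⇾q ∘ sym) u≢v (≢v i)

      solve : SPartition W
      solve with locate parts (∈W′ s∈ s≢u s≢v)
      solve | _ , _ , i , begins {ts = ts} Ss′ Ts c , oks , e′ = insert ts i Ts c oks e′
      solve | _ , _ , i , ends {s′} {ts} Ss′ Ts c , oks , e′ with ∈-++⁻ ts i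
      ... | inj₁ j = contradiction Ss (All.lookup Ts j)
      ... | inj₂ (here refl) with initLast ts
      ...   | [] = insert [] (here refl) [] [-] oks e′
      ...   | ts₁ ∷ʳ′ w with initLast ts₁
      ...     | [] = reinsert (u ∷ v ∷ []) (ends Ss (Tu ∷ Tv ∷ Ts) (u⇾v ∷ v⇾pred w∈ (chain-link [] c) ∷ c)) ↭-refl oks e′ e
        where w∈ = ∈-resp-↭ e′ (here refl)
      ...     | ts₂ ∷ʳ′ w₁ = ⊥-elim (no-long (All.lookup (all⇒ e′) i₁) (All.lookup (all⇒ e′) i₂)
                  (All.lookup Ts (∈-++⁺ˡ (∈-++⁺ʳ ts₂ (here refl)))) (All.lookup Ts (∈-++⁺ʳ (ts₂ ∷ʳ w₁) (here refl)))
                  (chain-link ts₂ (chain-++⁻ˡ _ c′)) (chain-link (ts₂ ∷ʳ w₁) (subst (Chain _⇾_) (++-assoc (ts₂ ∷ʳ w₁) (w ∷ []) (s ∷ [])) c)))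
        where
        i₁ : w₁ ∈ ((ts₂ ∷ʳ w₁) ∷ʳ w) ∷ʳ s
        i₁ = ∈-++⁺ˡ (∈-++⁺ˡ (∈-++⁺ʳ ts₂ (here refl)))
        i₂ : w ∈ ((ts₂ ∷ʳ w₁) ∷ʳ w) ∷ʳ s
        i₂ = ∈-++⁺ˡ (∈-++⁺ʳ (ts₂ ∷ʳ w₁) (here refl))
        c′ : Chain _⇾_ ((ts₂ ++ w₁ ∷ w ∷ []) ++ s ∷ [])
        c′ = subst (λ l → Chain _⇾_ (l ++ s ∷ [])) (++-assoc ts₂ (w₁ ∷ []) (w ∷ [])) c

-- Signs of vertices once no reduction applies

-- Arcs are confined to `W` here. `exchange` expresses maximality of S: if it failed, `m` could be
-- traded for both `a` and `b`.
record Reduced {V : Set} (𝕊 : Setting V) (W : List V) : Set where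
  open Paths 𝕊
  field
    source∈ : ∀ {a b} → a ⇾ b → a ∈ W
    target∈ : ∀ {a b} → a ⇾ b → b ∈ W
    out : ∀ {u v} → T u → T v → u ⇾ v → ∃ λ x → x ≢ v × u ⇾ x
    inn : ∀ {u v} → T u → T v → u ⇾ v → ∃ λ y → y ≢ u × y ⇾ v
    no-digon : ∀ {a b} → T a → T b → a ⇾ b → ¬ b ⇾ a
    no-through : ∀ {a b z} → T a → T b → a ⇾ b → a ⇾ z → ¬ z ⇾ b
    dominated : ∀ {t} → t ∈ W → T t → ∃ λ σ → S σ × Adj σ t
    exchange : ∀ {a b m} → a ∈ W → b ∈ W → T a → T b → a ≢ b → ¬ Adj a b → S m →
      ∃ λ σ → S σ × σ ≢ m × (Adj σ a ⊎ Adj σ b)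

reduced-op : ∀ {V} {𝕊 : Setting V} {W} → Reduced 𝕊 W → Reduced (op 𝕊) W
reduced-op {𝕊 = 𝕊} red = record
  { source∈ = target∈
  ; target∈ = source∈
  ; out = λ Tu Tv v⇾u → inn Tv Tu v⇾u
  ; inn = λ Tu Tv v⇾u → out Tv Tu v⇾u
  ; no-digon = λ Ta Tb b⇾a a⇾b → no-digon Ta Tb a⇾b b⇾a
  ; no-through = λ Ta Tb b⇾a z⇾a b⇾z → no-through Tb Ta b⇾a b⇾z z⇾a
  ; dominated = λ i Tt → let σ , Sσ , a = dominated i Tt in σ , Sσ , Sum.swap a
  ; exchange = λ i j Ta Tb a≢b ¬adj Sm →
      let σ , Sσ , σ≢m , a = exchange i j Ta Tb a≢b (¬adj ∘ Sum.swap) Sm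
      in σ , Sσ , σ≢m , Sum.map Sum.swap Sum.swap a
  }
  where open Reduced red

module Signs {V : Set} (𝕊 : Setting V) (W : List V) (red : Reduced 𝕊 W) where
  open Paths 𝕊 public
  open Reduced red public

  SourceIn SinkIn Pos Neg : V → Set
  SourceIn v = ∃ λ s → S s × s ⇾ v
  SinkIn v = ∃ λ s → S s × v ⇾ s
  Pos v = ∀ {s} → S s → ¬ s ⇾ v
  Neg v = ∀ {s} → S s → ¬ v ⇾ s

  source? : ∀ v → SourceIn v ⊎ Pos v
  source? v with any? (λ s → S? s ×-dec (s ⇾? v)) W
  ... | yes i with s , _ , Ss , r ← find i = inj₁ (s , Ss , r)
  ... | no ¬i = inj₂ (λ Ss r → ¬i (lose (source∈ r) (Ss , r)))

  neg⇒source : ∀ {v} → v ∈ W → T v → Neg v → SourceIn v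
  neg⇒source i Tv neg with dominated i Tv
  ... | σ , Sσ , inj₁ r = σ , Sσ , r
  ... | σ , Sσ , inj₂ r = contradiction r (neg Sσ)

  pos⇒sink : ∀ {v} → v ∈ W → T v → Pos v → SinkIn v
  pos⇒sink i Tv pos with dominated i Tv
  ... | σ , Sσ , inj₁ r = contradiction r (pos Sσ)
  ... | σ , Sσ , inj₂ r = σ , Sσ , r

  pos-neg : ∀ {v} → v ∈ W → T v → Pos v → ¬ Neg v
  pos-neg i Tv pos neg with σ , Sσ , r ← neg⇒source i Tv neg = pos Sσ r

  -- Distinct `s`, `s′` in S with `s → v ← u → s′` would be joined by an arc; if they coincide,
  -- `u → s → v` is an excluded passage.
  arc-neg : ∀ {u v} → T u → T v → u ⇾ v → SourceIn v → Neg u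
  arc-neg Tu Tv u⇾v (s , Ss , s⇾v) {s′} Ss′ u⇾s′ with s ≟ s′
  ... | yes refl = no-through Tu Tv u⇾v u⇾s′ s⇾v
  ... | no s≢s′ = stable Ss′ Ss (anti s⇾v u⇾v u⇾s′ (ST⇒≢ Ss Tu) (TS⇒≢ Tv Ss′) s≢s′)

  arc-pos : ∀ {u v} → T u → T v → u ⇾ v → SinkIn u → Pos v
  arc-pos Tu Tv u⇾v (s , Ss , u⇾s) Ss′ s′⇾v = arc-neg Tu Tv u⇾v (_ , Ss′ , s′⇾v) Ss u⇾s

  -- Tie-breakers for arcs of both kinds: `α` permits keeping `a → b`, `β` permits reversing it.
  α β : V → V → Set
  α a b = ∀ {y} → y ⇾ b → y ≢ a → Pos y
  β a b = ∀ {x} → a ⇾ x → x ≢ b → Neg x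

  -- A hot arc can be used both in paths ending in S and in paths starting in S.
  record Hot (u v : V) : Set where
    constructor hot
    field
      Tu : T u
      Tv : T v
      u⇾v : u ⇾ v
      neg : Neg u
      pos : Pos v

    out-T : ∀ {x} → u ⇾ x → T x
    out-T r Sx = neg Sx r

    inn-T : ∀ {y} → y ⇾ v → T y
    inn-T r Sy = pos Sy r

    source : SourceIn u
    source = neg⇒source (source∈ u⇾v) Tu neg

    sink : SinkIn v
    sink = pos⇒sink (target∈ u⇾v) Tv pos

    module _ {x y} (x≢v : x ≢ v) (u⇾x : u ⇾ x) (y≢u : y ≢ u) (y⇾v : y ⇾ v) where
      out≢inn : x ≢ y
      out≢inn refl = no-through Tu Tv u⇾v u⇾x y⇾v

      out⇾inn : x ⇾ y
      out⇾inn = anti y⇾v u⇾v u⇾x y≢u (x≢v ∘ sym) (out≢inn ∘ sym)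

  module _ {u v x y} (h : Hot u v) (x≢v : x ≢ v) (u⇾x : u ⇾ x) (y≢u : y ≢ u) (y⇾v : y ⇾ v) where
    open Hot h

    private
      Tx = out-T u⇾x
      Ty = inn-T y⇾v
      x⇾y = out⇾inn x≢v u⇾x y≢u y⇾v

    -- Half of the proof that x and y are not both restricted to one sign; the other half is its dual.
    source-of-inn : Neg x → Pos y → ∀ {l} → l ≢ x → l ⇾ y → SourceIn l
    source-of-inn negx posy {l} l≢x l⇾y with out (λ Sl → posy Sl l⇾y) Ty l⇾y
    ... | m , m≢y , l⇾m = go
      where
      Tl = λ Sl → posy Sl l⇾y

      m≢x : m ≢ x
      m≢x refl = no-through Tl Ty l⇾y l⇾m x⇾y

      m⇾x = anti x⇾y l⇾y l⇾m (l≢x ∘ sym) (m≢y ∘ sym) (m≢x ∘ sym)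

      m≢v : m ≢ v
      m≢v refl = no-through Tu Tx u⇾x u⇾v m⇾x

      ¬adj : ¬ Adj v x
      ¬adj (inj₁ v⇾x) = no-through Tu Tx u⇾x u⇾v v⇾x
      ¬adj (inj₂ x⇾v) = no-through Tu Tv u⇾v u⇾x x⇾v

      l≢v : l ≢ v
      l≢v refl = no-digon Ty Tv y⇾v l⇾y

      go : SourceIn l
      go with m ≟ u
      ... | yes refl = neg⇒source (source∈ l⇾m) Tl (arc-neg Tl Tu l⇾m source)
      ... | no m≢u with v⇾m ← anti m⇾x u⇾x u⇾v m≢u x≢v m≢v | S? m
      ...   | no Tm = ⊥-elim (pos-neg (target∈ u⇾x) Tx
                (arc-pos Tm Tx m⇾x (pos⇒sink (source∈ m⇾x) Tm (arc-pos Tv Tm v⇾m sink))) negx)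
      -- Trading `m` for `v` and `x` must fail, which gives a further `σ` in S. Whichever of them it
      -- is adjacent to, `v → σ` follows, and `l → m ← v → σ` yields `σ → l`.
      ...   | yes Sm with exchange (target∈ u⇾v) (target∈ u⇾x) Tv Tx (x≢v ∘ sym) ¬adj Sm
      ...     | σ , Sσ , σ≢m , adj = σ , Sσ , anti l⇾m v⇾m (v⇾σ adj) l≢v (σ≢m ∘ sym) (TS⇒≢ Tl Sσ)
        where
        v⇾σ : Adj σ v ⊎ Adj σ x → v ⇾ σ
        v⇾σ (inj₁ (inj₁ σ⇾v)) = contradiction σ⇾v (pos Sσ)
        v⇾σ (inj₁ (inj₂ v⇾σ)) = v⇾σ
        v⇾σ (inj₂ (inj₁ σ⇾x)) = anti σ⇾x u⇾x u⇾v (ST⇒≢ Sσ Tu) x≢v (ST⇒≢ Sσ Tv)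
        v⇾σ (inj₂ (inj₂ x⇾σ)) = contradiction x⇾σ (negx Sσ)

  -- If an in-neighbour `y` of `v` other than `u` receives an arc from S, then each other
  -- out-neighbour `x` of `u` has `x → y`, so `arc-neg` makes `x` negative.
  α⊎β : ∀ {u v} → Hot u v → α u v ⊎ β u v
  α⊎β {u} {v} h with any? (λ y → (y ⇾? v) ×-dec ¬? (y ≟ u) ×-dec any? (λ s → S? s ×-dec (s ⇾? y)) W) W
  ... | yes i with y , _ , y⇾v , y≢u , j ← find i with s , _ , Ss , s⇾y ← find j =
        inj₂ (λ u⇾x x≢v → arc-neg (out-T u⇾x) (inn-T y⇾v) (out⇾inn x≢v u⇾x y≢u y⇾v) (s , Ss , s⇾y))
    where open Hot h
  ... | no ¬i = inj₁ (λ y⇾v y≢u Ss s⇾y → ¬i (lose (source∈ y⇾v) (y⇾v , y≢u , lose (source∈ s⇾y) (Ss , s⇾y))))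

module Restricted {V : Set} (𝕊 : Setting V) (W : List V) (red : Reduced 𝕊 W) where
  open Signs 𝕊 W red public
  private module Op = Signs (op 𝕊) W (reduced-op red)

  -- Second neighbours `l → y` and `x → k` give `k → l`. By `source-of-inn` and its dual, `l` has an
  -- arc from S and `k` an arc to S, which `arc-neg` forbids. In particular `α` and `β` exclude each
  -- other on a hot arc.
  not-both : ∀ {u v x y} → Hot u v → x ≢ v → u ⇾ x → y ≢ u → y ⇾ v → Neg x → ¬ Pos y
  not-both h x≢v u⇾x y≢u y⇾v negx posy =
    let open Hot h
        x⇾y = out⇾inn x≢v u⇾x y≢u y⇾v
        l , l≢x , l⇾y = inn (out-T u⇾x) (inn-T y⇾v) x⇾y
        k , k≢y , x⇾k = out (out-T u⇾x) (inn-T y⇾v) x⇾y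
        Tl = λ Sl → posy Sl l⇾y
        Tk = λ Sk → negx Sk x⇾k
        k≢l = λ k≡l → no-through (out-T u⇾x) (inn-T y⇾v) x⇾y x⇾k (subst (_⇾ _) (sym k≡l) l⇾y)
        k⇾l = anti l⇾y x⇾y x⇾k l≢x (k≢y ∘ sym) (k≢l ∘ sym)
        _ , Ss , k⇾s = Op.source-of-inn (Op.hot Tv Tu u⇾v pos neg) y≢u y⇾v x≢v u⇾x posy negx k≢y x⇾k
    in arc-neg Tk Tl k⇾l (source-of-inn h x≢v u⇾x y≢u y⇾v negx posy l≢x l⇾y) Ss k⇾s

  -- The situation at a turn: `u → x` is reversed, `u → v` is kept, and `y` is the vertex that is to
  -- take over the tail from `v`.
  module Bad {u v x} (h : Hot u v) (αuv : α u v) (x≢v : x ≢ v) (u⇾x : u ⇾ x) (¬pos-x : ¬ Pos x)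
    {y} (y≢u : y ≢ u) (y⇾v : y ⇾ v) where
    open Hot h

    Tx = out-T u⇾x
    Ty = inn-T y⇾v
    x⇾y = out⇾inn x≢v u⇾x y≢u y⇾v
    x≢y = out≢inn x≢v u⇾x y≢u y⇾v

    pos-y : Pos y
    pos-y = αuv y⇾v y≢u

    ¬neg-x : ¬ Neg x
    ¬neg-x negx = not-both h x≢v u⇾x y≢u y⇾v negx pos-y

    sink-y : SinkIn y
    sink-y = pos⇒sink (source∈ y⇾v) Ty pos-y

    ¬y⇾u : ¬ y ⇾ u
    ¬y⇾u y⇾u = no-through Ty Tv y⇾v y⇾u u⇾v

    ¬u⇾y : ¬ u ⇾ y
    ¬u⇾y u⇾y = no-through Tu Tv u⇾v u⇾y y⇾v

    ¬v⇾x : ¬ v ⇾ x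
    ¬v⇾x = no-through Tu Tx u⇾x u⇾v

    out-y : ∀ {e} → y ⇾ e → e ≢ v → e ⇾ u
    out-y y⇾e e≢v = anti u⇾v y⇾v y⇾e (y≢u ∘ sym) (e≢v ∘ sym) λ { refl → ¬y⇾u y⇾e }

    -- So `u` can take over the S-vertex after `y`: in the redirected digraph the original direction
    -- of an arc at S is immaterial.
    S-out-y : ∀ {s} → S s → y ⇾ s → s ⇾ u
    S-out-y Ss y⇾s = out-y y⇾s (ST⇒≢ Ss Tv)

    -- Hence the only arc from `y` inside T that can be kept is the one to `v`.
    T-out-y : ∀ {e} → T e → e ≢ v → y ⇾ e → ¬ Pos e
    T-out-y Te e≢v y⇾e pos-e = pos-neg (target∈ y⇾e) Te pos-e (arc-neg Te Tu (out-y y⇾e e≢v) source)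

    -- A second out-neighbour `k` of `e` other than `u` would satisfy `k → x` and then `v → k`, so
    -- it would be `Pos`, while `β` makes it `Neg`.
    into-y : ∀ {e} → T e → e ⇾ y → Neg e → β e y → e ⇾ u
    into-y {e} Te e⇾y neg-e βey with out Te Ty e⇾y
    ... | k , k≢y , e⇾k with k ≟ u
    ...   | yes refl = e⇾k
    ...   | no k≢u = ⊥-elim (pos-neg (target∈ e⇾k) Tk (arc-pos Tv Tk v⇾k sink) (βey e⇾k k≢y))
      where
      Tk = λ Sk → neg-e Sk e⇾k
      x≢e : x ≢ e
      x≢e refl = ¬neg-x neg-e
      x≢k : x ≢ k
      x≢k refl = no-through Te Ty e⇾y e⇾k x⇾y
      k⇾x = anti x⇾y e⇾y e⇾k x≢e (k≢y ∘ sym) x≢k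
      k≢v : k ≢ v
      k≢v refl = ¬v⇾x k⇾x
      v⇾k = anti k⇾x u⇾x u⇾v k≢u x≢v k≢v

    -- Since `u` and `y` are nonadjacent, maximality yields a second S-vertex `τ` with `y → τ → u`.
    -- Together with `τ`, any further neighbour of `σ` would contradict the signs of `v` or `e`, so
    -- `σ` is adjacent to `u` and `y` only.
    module Isolated {e} (Te : T e) (neg-e : Neg e) (e⇾y : e ⇾ y) (e⇾u : e ⇾ u) {σ} (Sσ : S σ) (y⇾σ : y ⇾ σ) where
      σ⇾u = S-out-y Sσ y⇾σ

      private
        twin : ∃ λ τ → S τ × τ ≢ σ × y ⇾ τ × τ ⇾ u
        twin with exchange (source∈ u⇾v) (source∈ y⇾v) Tu Ty (y≢u ∘ sym) (λ { (inj₁ r) → ¬u⇾y r ; (inj₂ r) → ¬y⇾u r }) Sσ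
        ... | τ , Sτ , τ≢σ , inj₁ (inj₁ τ⇾u) = τ , Sτ , τ≢σ , anti τ⇾u e⇾u e⇾y (ST⇒≢ Sτ Te) (y≢u ∘ sym) (ST⇒≢ Sτ Ty) , τ⇾u
        ... | τ , Sτ , τ≢σ , inj₁ (inj₂ u⇾τ) = contradiction u⇾τ (neg Sτ)
        ... | τ , Sτ , τ≢σ , inj₂ (inj₁ τ⇾y) = contradiction τ⇾y (pos-y Sτ)
        ... | τ , Sτ , τ≢σ , inj₂ (inj₂ y⇾τ) = τ , Sτ , τ≢σ , y⇾τ , S-out-y Sτ y⇾τ

      only-out : ∀ {d} → T d → σ ⇾ d → d ≡ u
      only-out {d} Td σ⇾d with d ≟ u
      ... | yes d≡u = d≡u
      ... | no d≢u with τ , Sτ , τ≢σ , y⇾τ , τ⇾u ← twin = contradiction σ⇾d (arc-pos Tv Td v⇾d sink Sσ)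
        where
        d⇾τ = anti τ⇾u σ⇾u σ⇾d τ≢σ (d≢u ∘ sym) (ST⇒≢ Sτ Td)
        v⇾d = anti d⇾τ y⇾τ y⇾v (λ { refl → pos-y Sσ σ⇾d }) (ST⇒≢ Sτ Tv) (λ { refl → pos Sσ σ⇾d })

      only-in : ∀ {c} → T c → c ⇾ σ → c ≡ y
      only-in {c} Tc c⇾σ with c ≟ y
      ... | yes c≡y = c≡y
      ... | no c≢y with τ , Sτ , τ≢σ , y⇾τ , τ⇾u ← twin =
            contradiction c⇾σ (arc-neg Tc Te c⇾e (neg⇒source (source∈ e⇾y) Te neg-e) Sσ)
        where
        τ⇾c = anti c⇾σ y⇾σ y⇾τ c≢y (τ≢σ ∘ sym) (TS⇒≢ Tc Sτ)
        c⇾e = anti e⇾u τ⇾u τ⇾c (TS⇒≢ Te Sτ) (λ { refl → neg Sσ c⇾σ }) (λ { refl → neg-e Sσ c⇾σ })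

    -- This excludes that `y` follows `v` on one path, with `b` just after `v` and `b′` just before
    -- `y`. A second out-neighbour `m` of `b′` satisfies `v → m` and lies in S. If `b ≠ b′`, trading
    -- `m` for `v` and `b′` leads to a contradiction.
    no-cycle : ∀ {b b′ e} → T b → T b′ → v ⇾ b → Pos b → b′ ⇾ y → (Neg b′ → α b′ y) → b′ ≢ x → S e → ¬ y ⇾ e
    no-cycle {b} {b′} {e} Tb Tb′ v⇾b pos-b b′⇾y αb′y b′≢x Se y⇾e with out Tb′ Ty b′⇾y
    ... | m , m≢y , b′⇾m = go
      where
      ¬neg-b′ : ¬ Neg b′
      ¬neg-b′ neg-b′ = ¬pos-x (αb′y neg-b′ x⇾y (b′≢x ∘ sym))

      m≢x : m ≢ x
      m≢x refl = no-through Tb′ Ty b′⇾y b′⇾m x⇾y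

      m⇾x = anti x⇾y b′⇾y b′⇾m (b′≢x ∘ sym) (m≢y ∘ sym) (m≢x ∘ sym)

      m≢u : m ≢ u
      m≢u refl = ¬neg-b′ (arc-neg Tb′ Tu b′⇾m source)

      m≢v : m ≢ v
      m≢v refl = ¬v⇾x m⇾x

      b′≢v : b′ ≢ v
      b′≢v refl = no-digon Ty Tv y⇾v b′⇾y

      v⇾m = anti m⇾x u⇾x u⇾v m≢u x≢v m≢v

      Sm : S m
      Sm with S? m
      ... | yes Sm = Sm
      ... | no Tm = ⊥-elim (¬pos-x (arc-pos Tm Tx m⇾x (pos⇒sink (source∈ m⇾x) Tm (arc-pos Tv Tm v⇾m sink))))

      go : ⊥
      go with b ≟ b′
      ... | no b≢b′ with b⇾b′ ← anti b′⇾m v⇾m v⇾b b′≢v (ST⇒≢ Sm Tb) (b≢b′ ∘ sym)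
        with exchange (target∈ u⇾v) (source∈ b′⇾y) Tv Tb′ (b′≢v ∘ sym)
               (λ { (inj₁ v⇾b′) → no-through Tv Tb′ v⇾b′ v⇾b b⇾b′
                  ; (inj₂ b′⇾v) → no-through Tb′ Tv b′⇾v b′⇾y y⇾v }) Sm
      ...   | σ , Sσ , σ≢m , adj = absurd adj
        where
        absurd : ¬ (Adj σ v ⊎ Adj σ b′)
        absurd (inj₁ (inj₁ σ⇾v)) = pos Sσ σ⇾v
        absurd (inj₁ (inj₂ v⇾σ)) = arc-pos Tb Tb′ b⇾b′ (pos⇒sink (target∈ v⇾b) Tb pos-b) Sσ
          (anti b′⇾m v⇾m v⇾σ b′≢v (σ≢m ∘ sym) (TS⇒≢ Tb′ Sσ))
        absurd (inj₂ (inj₁ σ⇾b′)) = arc-pos Tb Tb′ b⇾b′ (pos⇒sink (target∈ v⇾b) Tb pos-b) Sσ σ⇾b′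
        absurd (inj₂ (inj₂ b′⇾σ)) = pos Sσ (anti v⇾m b′⇾m b′⇾σ (b′≢v ∘ sym) (σ≢m ∘ sym) (TS⇒≢ Tv Sσ))
      -- Now `b → y → e` and `b → e` form a blocking triangle. `no-through` is silent here because
      -- `e` lies in S, so `tri` is applied directly.
      go | yes refl with inn Tv Tb v⇾b
      ... | l , l≢v , l⇾b = absurd (tri b⇾e b′⇾y y⇾e)
        where
        Tl = λ Sl → pos-b Sl l⇾b
        m⇾l = anti l⇾b v⇾b v⇾m l≢v (TS⇒≢ Tb Sm) (TS⇒≢ Tl Sm)
        l⇾u = anti u⇾x m⇾x m⇾l (m≢u ∘ sym) (λ { refl → no-through Tx Ty x⇾y l⇾b b′⇾y })
                (λ { refl → no-through Tu Tb l⇾b u⇾v v⇾b })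
        b⇾e = anti (S-out-y Se y⇾e) l⇾u l⇾b (ST⇒≢ Se Tl) (λ { refl → no-digon Tu Tv u⇾v v⇾b }) (ST⇒≢ Se Tb)
        absurd : ¬ (e ⇾ b ⊎ y ⇾ b ⊎ e ⇾ y)
        absurd (inj₁ e⇾b) = pos-b Se e⇾b
        absurd (inj₂ (inj₁ y⇾b)) = no-digon Tb Ty b′⇾y y⇾b
        absurd (inj₂ (inj₂ e⇾y)) = pos-y Se e⇾y

-- The redirected digraph and layouts of its paths

module Ends {V : Set} (S : V → Set) where

  data Ended : List V → Set where
    [] : Ended []
    last : ∀ {s} → S s → Ended (s ∷ [])
    _∷_ : ∀ x {y ys} → Ended (y ∷ ys) → Ended (x ∷ y ∷ ys)

  ended-++⁻ : ∀ A {B} → Ended (A ++ B) → Ended B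
  ended-++⁻ [] e = e
  ended-++⁻ (a ∷ []) (last _) = []
  ended-++⁻ (a ∷ []) (_ ∷ e) = e
  ended-++⁻ (a ∷ a′ ∷ A) (_ ∷ e) = ended-++⁻ (a′ ∷ A) e

  ended-++⁺ : ∀ A {b B} → Ended (b ∷ B) → Ended (A ++ b ∷ B)
  ended-++⁺ [] e = e
  ended-++⁺ (a ∷ []) e = a ∷ e
  ended-++⁺ (a ∷ a′ ∷ A) e = a ∷ ended-++⁺ (a′ ∷ A) e

  ended-++ : ∀ {A B} → Ended A → Ended B → Ended (A ++ B)
  ended-++ [] e = e
  ended-++ (last Ss) [] = last Ss
  ended-++ (last Ss) e@(last _) = _ ∷ e
  ended-++ (last Ss) e@(_ ∷ _) = _ ∷ e
  ended-++ (x ∷ d) e = x ∷ ended-++ d e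

  ended-S : ∀ A {s B} → S s → Ended B → Ended (A ++ s ∷ B)
  ended-S A Ss [] = ended-++⁺ A (last Ss)
  ended-S A Ss e@(last _) = ended-++⁺ A (_ ∷ e)
  ended-S A Ss e@(_ ∷ _) = ended-++⁺ A (_ ∷ e)

  ended-next : ∀ {a B} → ¬ S a → Ended (a ∷ B) → ∃₂ λ b B′ → B ≡ b ∷ B′
  ended-next ¬Sa (last Sa) = contradiction Sa ¬Sa
  ended-next ¬Sa (_ ∷ _) = _ , _ , refl

module Star {V : Set} (𝕊 : Setting V) (W : List V) (red : Reduced 𝕊 W) where
  open Restricted 𝕊 W red public
  open Ends S public

  -- A kept arc. If it could be reversed as well, that is if `Neg a`, the choice must be backed by
  -- `α`; `Bwd` is the mirror image.
  record Fwd (a b : V) : Set where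
    constructor fwd
    field
      Ta : T a
      Tb : T b
      step : a ⇾ b
      pos : Pos b
      neg⇒α : Neg a → α a b

  record Bwd (a b : V) : Set where
    constructor bwd
    field
      Ta : T a
      Tb : T b
      step : a ⇾ b
      neg : Neg a
      pos⇒β : Pos b → β a b

  -- Paths are built inside V \ S and directed towards their vertex in S: an arc that is only usable
  -- in paths starting in S is reversed.
  infix 4 _⟶_
  data _⟶_ (a b : V) : Set where
    toS : T a → S b → Adj a b → a ⟶ b
    forward : Fwd a b → a ⟶ b
    backward : Bwd b a → a ⟶ b

  -- All paths are written one after another in a single list. An S-vertex closes its path, so
  -- anything may follow it, and exchanging tails becomes rearranging blocks.
  Link : V → V → Set
  Link a b = S a ⊎ a ⟶ b

  link-T : ∀ {a b} → T a → Link a b → a ⟶ b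
  link-T Ta (inj₁ Sa) = contradiction Sa Ta
  link-T Ta (inj₂ r) = r

  ⟶⇒T : ∀ {a b} → a ⟶ b → T a
  ⟶⇒T (toS Ta _ _) = Ta
  ⟶⇒T (forward f) = Fwd.Ta f
  ⟶⇒T (backward b) = Bwd.Tb b

  chain-ended : ∀ {A B} → Chain Link A → Ended A → Chain Link B → Chain Link (A ++ B)
  chain-ended [] [] d = d
  chain-ended {B = []} [-] (last Ss) d = [-]
  chain-ended {B = b ∷ B} [-] (last Ss) d = inj₁ Ss ∷ d
  chain-ended (r ∷ c) (_ ∷ e) d = r ∷ chain-ended c e d

  pos? : ∀ v → Dec (Pos v)
  pos? v with source? v
  ... | inj₁ (s , Ss , s⇾v) = no (λ pos → pos Ss s⇾v)
  ... | inj₂ pos = yes pos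

  HotPair : V → V → Set
  HotPair a b = Hot a b ⊎ Hot b a

  private module Op = Signs (op 𝕊) W (reduced-op red)

  neg? : ∀ v → Dec (Neg v)
  neg? v with Op.source? v
  ... | inj₁ (s , Ss , v⇾s) = no (λ neg → neg Ss v⇾s)
  ... | inj₂ neg = yes neg

  α? : ∀ a b → Dec (α a b)
  α? a b with any? (λ y → (y ⇾? b) ×-dec ¬? (y ≟ a) ×-dec ¬? (pos? y)) W
  ... | yes i with y , _ , y⇾b , y≢a , ¬pos ← find i = no (λ all → ¬pos (all y⇾b y≢a))
  ... | no ¬i = yes (λ {y} y⇾b y≢a → case pos? y of λ
    { (yes pos) → pos ; (no ¬pos) → contradiction (lose (source∈ y⇾b) (y⇾b , y≢a , ¬pos)) ¬i })

  β? : ∀ a b → Dec (β a b)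
  β? a b with any? (λ x → (a ⇾? x) ×-dec ¬? (x ≟ b) ×-dec ¬? (neg? x)) W
  ... | yes i with x , _ , a⇾x , x≢b , ¬neg ← find i = no (λ all → ¬neg (all a⇾x x≢b))
  ... | no ¬i = yes (λ {x} a⇾x x≢b → case neg? x of λ
    { (yes neg) → neg ; (no ¬neg) → contradiction (lose (target∈ a⇾x) (a⇾x , x≢b , ¬neg)) ¬i })

  equivalent : {P Q : Set} → Dec P → (P → Q) → (Q → P) → Dec Q
  equivalent d f g = map′ f g d

  T? : ∀ a → Dec (T a)
  T? a = ¬? (S? a)

  hotPair? : ∀ a b → Dec (HotPair a b)
  hotPair? a b = hot? a b ⊎-dec hot? b a
    where
    hot? : ∀ a b → Dec (Hot a b)
    hot? a b = equivalent (T? a ×-dec T? b ×-dec (a ⇾? b) ×-dec neg? a ×-dec pos? b)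
      (λ (Ta , Tb , r , n , p) → hot Ta Tb r n p) (λ (hot Ta Tb r n p) → Ta , Tb , r , n , p)

  fwd? : ∀ a b → Dec (Fwd a b)
  fwd? a b = equivalent (T? a ×-dec T? b ×-dec (a ⇾? b) ×-dec pos? b ×-dec (neg? a →-dec α? a b))
    (λ (Ta , Tb , r , p , c) → fwd Ta Tb r p c) (λ (fwd Ta Tb r p c) → Ta , Tb , r , p , c)

  bwd? : ∀ a b → Dec (Bwd a b)
  bwd? a b = equivalent (T? a ×-dec T? b ×-dec (a ⇾? b) ×-dec neg? a ×-dec (pos? b →-dec β? a b))
    (λ (Ta , Tb , r , n , c) → bwd Ta Tb r n c) (λ (bwd Ta Tb r n c) → Ta , Tb , r , n , c)

  _⟶?_ : Decidable _⟶_
  a ⟶? b = equivalent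
    ((T? a ×-dec S? b ×-dec ((a ⇾? b) ⊎-dec (b ⇾? a))) ⊎-dec (fwd? a b ⊎-dec bwd? b a))
    (λ { (inj₁ (Ta , Sb , r)) → toS Ta Sb r ; (inj₂ (inj₁ f)) → forward f ; (inj₂ (inj₂ g)) → backward g })
    (λ { (toS Ta Sb r) → inj₁ (Ta , Sb , r) ; (forward f) → inj₂ (inj₁ f) ; (backward g) → inj₂ (inj₂ g) })

  -- No adjacency is lost in redirecting, so stable sets do not grow and Gallai-Milgram gives at
  -- most |S| paths.
  arc⇒⟶ : ∀ {a b} → a ⇾ b → a ⟶ b ⊎ b ⟶ a
  arc⇒⟶ {a} {b} r with S? a | S? b
  ... | yes Sa | yes Sb = contradiction r (stable Sa Sb)
  ... | yes Sa | no Tb = inj₂ (toS Tb Sa (inj₂ r))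
  ... | no Ta | yes Sb = inj₁ (toS Ta Sb (inj₁ r))
  ... | no Ta | no Tb with source? b
  ...   | inj₁ src = inj₂ (backward (bwd Ta Tb r (arc-neg Ta Tb r src)
            (λ pos → let s , Ss , s⇾b = src in contradiction s⇾b (pos Ss))))
  ...   | inj₂ pos with neg? a
  ...     | no ¬neg = inj₁ (forward (fwd Ta Tb r pos (λ neg → ⊥-elim (¬neg neg))))
  ...     | yes neg with α⊎β (hot Ta Tb r neg pos)
  ...       | inj₁ αab = inj₁ (forward (fwd Ta Tb r pos (λ _ → αab)))
  ...       | inj₂ βab = inj₂ (backward (bwd Ta Tb r neg (λ _ → βab)))

  -- Symmetric in its arguments, hence unchanged when the digraph is reversed. The step from one
  -- path to the next weighs 0, because hot arcs avoid S.
  weight : V → V → ℕ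
  weight a b = if does (hotPair? a b) then 1 else 0

  weight-hot : ∀ {a b} → HotPair a b → weight a b ≡ 1
  weight-hot h = cong (if_then 1 else 0) (dec-true (hotPair? _ _) h)

  weight-cold : ∀ {a b} → ¬ HotPair a b → weight a b ≡ 0
  weight-cold ¬h = cong (if_then 1 else 0) (dec-false (hotPair? _ _) ¬h)

  weight-toS : ∀ {a s} → S s → weight a s ≡ 0
  weight-toS Ss = weight-cold λ { (inj₁ h) → Hot.Tv h Ss ; (inj₂ h) → Hot.Tu h Ss }

  weight-fromS : ∀ {s b} → S s → weight s b ≡ 0
  weight-fromS Ss = weight-cold λ { (inj₁ h) → Hot.Tu h Ss ; (inj₂ h) → Hot.Tv h Ss }

  total : List V → ℕ
  total [] = 0
  total (a ∷ []) = 0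
  total (a ∷ b ∷ F) = weight a b + total (b ∷ F)

  total-S∷ : ∀ {s} → S s → ∀ F → total (s ∷ F) ≡ total F
  total-S∷ Ss [] = refl
  total-S∷ Ss (b ∷ F) rewrite weight-fromS {b = b} Ss = refl

  total-join : ∀ A {a b B} → total (A ++ a ∷ b ∷ B) ≡ total (A ∷ʳ a) + (weight a b + total (b ∷ B))
  total-join [] = refl
  total-join (x ∷ []) {a} {b} {B} = cong (_+ (weight a b + total (b ∷ B))) (sym (+-identityʳ (weight x a)))
  total-join (x ∷ y ∷ A) {a} {b} {B} = trans (cong (weight x y +_) (total-join (y ∷ A)))
    (sym (+-assoc (weight x y) (total ((y ∷ A) ∷ʳ a)) _))

  total-join-S : ∀ A {a s B} → S s → total (A ++ a ∷ s ∷ B) ≡ total (A ∷ʳ a) + total B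
  total-join-S A {a} {s} {B} Ss = trans (total-join A) (cong (total (A ∷ʳ a) +_)
    (cong₂ _+_ (weight-toS Ss) (total-S∷ Ss B)))

  total-S : ∀ A {s B} → S s → total (A ++ s ∷ B) ≡ total A + total B
  total-S [] {B = B} Ss = total-S∷ Ss B
  total-S (a ∷ []) {B = B} Ss = total-join-S [] {B = B} Ss
  total-S (a ∷ b ∷ A) Ss = trans (cong (weight a b +_) (total-S (b ∷ A) Ss)) (sym (+-assoc (weight a b) _ _))

  total-ended : ∀ {A B} → Ended A → total (A ++ B) ≡ total A + total B
  total-ended [] = refl
  total-ended {B = B} (last Ss) = total-S∷ Ss B
  total-ended (x ∷ e) = trans (cong (weight x _ +_) (total-ended e)) (sym (+-assoc (weight x _) _ _))

  record Layout (F : List V) : Set where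
    constructor layout
    field
      chain : Chain Link F
      ended : Ended F
      covers : F ↭ W

  -- Exchanging tails at a turn

  -- The pair `u`, `v` is hot and gets separated. The new pairs weigh 0: `y`, `v` because `y` is not
  -- `Neg` and no digon lies in T, the others because they contain an S-vertex.
  module Fix {L u v Z} (uniq : Unique (L ++ u ∷ v ∷ Z)) (lay : Layout (L ++ u ∷ v ∷ Z))
    {x} (x∈L : x ∈ L) (ux : Bwd u x) (uv : Fwd u v) where

    private
      F = L ++ u ∷ v ∷ Z
      open Layout lay
      h : Hot u v
      h = hot (Bwd.Ta ux) (Fwd.Tb uv) (Fwd.step uv) (Bwd.neg ux) (Fwd.pos uv)
      open Hot h using (Tu; Tv; neg; pos; u⇾v)

      αuv : α u v
      αuv = Fwd.neg⇒α uv neg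

      u⇾x = Bwd.step ux

      x≢v : x ≢ v
      x≢v refl = unique-disjoint L uniq x∈L (there (here refl))

      -- Otherwise reversing `u → x` would have required `β`, which makes `v` both `Neg` and `Pos`.
      ¬pos-x : ¬ Pos x
      ¬pos-x pos-x = pos-neg (target∈ u⇾v) Tv pos (Bwd.pos⇒β ux pos-x u⇾v (x≢v ∘ sym))

      Better : Set
      Better = ∃ λ F′ → Layout F′ × total F′ < total F

      chain-uvZ : Chain Link (u ∷ v ∷ Z)
      chain-uvZ = chain-++⁻ʳ L chain

      chain-vZ : Chain Link (v ∷ Z)
      chain-vZ = Linked.tail chain-uvZ

      ended-vZ : Ended (v ∷ Z)
      ended-vZ with _ ∷ e ← ended-++⁻ L ended = e

      weight-uv : weight u v ≡ 1
      weight-uv = weight-hot (inj₁ h)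

      module Swap {y} (y≢u : y ≢ u) (y⇾v : y ⇾ v) where
        open Bad h αuv x≢v u⇾x ¬pos-x y≢u y⇾v

        y∈F : y ∈ F
        y∈F = ∈-resp-↭ (↭-sym covers) (source∈ y⇾v)

        ¬neg-y : ¬ Neg y
        ¬neg-y = pos-neg (source∈ y⇾v) Ty pos-y

        y⟶v : y ⟶ v
        y⟶v = forward (fwd Ty Tv y⇾v pos (λ neg-y → ⊥-elim (¬neg-y neg-y)))

        weight-yv : weight y v ≡ 0
        weight-yv = weight-cold λ
          { (inj₁ h′) → ¬neg-y (Hot.neg h′) ; (inj₂ h′) → no-digon Ty Tv y⇾v (Hot.u⇾v h′) }

        next-y : ∀ {e} → y ⟶ e → e ≢ v → (S e × y ⇾ e) ⊎ (Bwd e y × e ⇾ u)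
        next-y (toS _ Se (inj₁ y⇾e)) e≢v = inj₁ (Se , y⇾e)
        next-y (toS _ Se (inj₂ e⇾y)) e≢v = contradiction e⇾y (pos-y Se)
        next-y (forward (fwd _ Te y⇾e pos-e _)) e≢v = ⊥-elim (T-out-y Te e≢v y⇾e pos-e)
        next-y (backward g@(bwd Te _ e⇾y neg-e c)) e≢v = inj₂ (g , into-y Te e⇾y neg-e (c pos-y))

        u⟶ : ∀ {s} → S s → y ⇾ s → u ⟶ s
        u⟶ Ss y⇾s = toS Tu Ss (inj₂ (S-out-y Ss y⇾s))

        module _ {e P Q σ} (g : Bwd e y) (e⇾u : e ⇾ u) (F≡ : F ≡ P ++ y ∷ e ∷ Q) (Sσ : S σ) (y⇾σ : y ⇾ σ) where
          private
            open Bwd g renaming (Ta to Te; step to e⇾y; neg to neg-e)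
            open Isolated Te neg-e e⇾y e⇾u Sσ y⇾σ

            -- A predecessor of `σ` on its path could only be `y` or `u`, but these are followed by
            -- `e` and `v`, which are not in S. So `σ` is a path by itself.
            detached : ∀ A B → F ≡ A ++ σ ∷ B → Ended A
            detached A B F≡A with initLast A
            ... | [] = []
            ... | A′ ∷ʳ′ c = go (chain-link A′ (subst (Chain Link) F≡A′ chain))
              where
              F≡A′ : F ≡ A′ ++ c ∷ σ ∷ B
              F≡A′ = trans F≡A (++-assoc A′ (c ∷ []) (σ ∷ B))
              go : Link c σ → Ended (A′ ∷ʳ c)
              go (inj₁ Sc) = ended-++⁺ A′ (last Sc)
              go (inj₂ (toS Tc _ (inj₁ c⇾σ))) with refl ← only-in Tc c⇾σ =
                contradiction Sσ (subst T (successor-unique P A′ uniq F≡ F≡A′) Te)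
              go (inj₂ (toS Tc _ (inj₂ σ⇾c))) with refl ← only-out Tc σ⇾c =
                contradiction Sσ (subst T (successor-unique L A′ uniq refl F≡A′) Tv)
              go (inj₂ (forward f)) = contradiction Sσ (Fwd.Tb f)
              go (inj₂ (backward f)) = contradiction Sσ (Bwd.Ta f)

            -- The lone vertex `σ` moves behind `u`, and the tail from `v` becomes a path of its
            -- own, so the number of paths stays the same.
            before : ∀ A B → L ≡ A ++ σ ∷ B → Better
            before A B refl = F′ , layout chain′ ended′ (↭-trans perm covers) , less
              where
              F≡A : F ≡ A ++ σ ∷ B ++ u ∷ v ∷ Z
              F≡A = ++-assoc A (σ ∷ B) (u ∷ v ∷ Z)
              end-A = detached A _ F≡A
              F′ = A ++ (B ++ u ∷ σ ∷ v ∷ Z)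
              chainA = subst (Chain Link) F≡A chain
              chainB = Linked.tail (chain-++⁻ʳ A chainA)
              chain′ : Chain Link F′
              chain′ = chain-ended (chain-++⁻ˡ A chainA) end-A
                (chain-join B (chain-prefix B chainB) (inj₂ (u⟶ Sσ y⇾σ)) (inj₁ Sσ ∷ chain-vZ))
              ended′ : Ended F′
              ended′ = ended-++ end-A (ended-++⁺ B (u ∷ (σ ∷ ended-vZ)))
              perm : F′ ↭ F
              perm = ↭-trans (++⁺ˡ A (shift₂ B u σ (v ∷ Z))) (↭-reflexive (sym F≡A))
              less : total F′ < total F
              less = ≤-reflexive (begin
                suc (total F′)
                  ≡⟨ cong suc (trans (total-ended end-A) (cong (total A +_) (total-join-S B Sσ))) ⟩
                suc (total A + (total (B ∷ʳ u) + total (v ∷ Z)))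
                  ≡⟨ sucs (total A) (total (B ∷ʳ u)) (total (v ∷ Z)) ⟩
                total A + (total (B ∷ʳ u) + (1 + total (v ∷ Z)))
                  ≡⟨ cong (λ w → total A + (total (B ∷ʳ u) + (w + total (v ∷ Z)))) weight-uv ⟨
                total A + (total (B ∷ʳ u) + (weight u v + total (v ∷ Z)))
                  ≡⟨ cong (total A +_) (total-join B) ⟨
                total A + total (B ++ u ∷ v ∷ Z)
                  ≡⟨ total-S A Sσ ⟨
                total (A ++ σ ∷ B ++ u ∷ v ∷ Z)
                  ≡⟨ cong total F≡A ⟨
                total F ∎)
                where
                open ≡-Reasoning
                sucs : ∀ a b c → suc (a + (b + c)) ≡ a + (b + (1 + c))
                sucs = solve-∀

            after : ∀ A B → Z ≡ A ++ σ ∷ B → Better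
            after A B refl = F′ , layout chain′ ended′ (↭-trans perm covers) , less
              where
              end-vA : Ended (v ∷ A)
              end-vA with _ ∷ e ← ended-++⁻ L (detached (L ++ u ∷ v ∷ A) B (sym (++-assoc L (u ∷ v ∷ A) (σ ∷ B)))) = e
              chain-B = chain-++⁻ʳ (σ ∷ []) (chain-++⁻ʳ (v ∷ A) chain-vZ)
              F′ = L ++ u ∷ σ ∷ v ∷ A ++ B
              chain′ : Chain Link F′
              chain′ = chain-join L (chain-prefix L chain) (inj₂ (u⟶ Sσ y⇾σ))
                (inj₁ Sσ ∷ chain-ended (chain-++⁻ˡ (v ∷ A) chain-vZ) end-vA chain-B)
              ended′ : Ended F′
              ended′ = ended-++⁺ L (u ∷ (σ ∷ ended-++ end-vA (ended-++⁻ (σ ∷ []) (ended-++⁻ (v ∷ A) ended-vZ))))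
              perm : F′ ↭ F
              perm = ++⁺ˡ L (prep u (↭-sym (shift σ (v ∷ A) B)))
              less : total F′ < total F
              less = ≤-reflexive (begin
                suc (total F′)
                  ≡⟨ cong suc (trans (total-join-S L Sσ) (cong (total (L ∷ʳ u) +_) (total-ended end-vA))) ⟩
                suc (total (L ∷ʳ u) + (total (v ∷ A) + total B))
                  ≡⟨ +-suc (total (L ∷ʳ u)) _ ⟨
                total (L ∷ʳ u) + (1 + (total (v ∷ A) + total B))
                  ≡⟨ cong₂ (λ w r → total (L ∷ʳ u) + (w + r)) weight-uv (total-S (v ∷ A) Sσ) ⟨
                total (L ∷ʳ u) + (weight u v + total (v ∷ A ++ σ ∷ B))
                  ≡⟨ total-join L ⟨
                total F ∎)
                where open ≡-Reasoning

          isolated : Better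
          isolated with ∈-++⁻ L (∈-resp-↭ (↭-sym covers) (target∈ y⇾σ))
          ... | inj₁ i with A , B , L≡ ← ∈-∃++ i = before A B L≡
          ... | inj₂ (here refl) = contradiction Sσ Tu
          ... | inj₂ (there (here refl)) = contradiction Sσ Tv
          ... | inj₂ (there (there i)) with A , B , Z≡ ← ∈-∃++ i = after A B Z≡

        -- The path of `y` comes before that of `u`. Everything from `v` to the end of the list
        -- moves behind `y`; later paths simply travel along.
        swap-before : ∀ {e} A B → L ≡ A ++ y ∷ e ∷ B → S e → y ⇾ e → Better
        swap-before {e} A B refl Se y⇾e = F′ , layout chain′ ended′ (↭-trans perm covers) , less
          where
          F≡ : F ≡ A ++ y ∷ e ∷ B ++ u ∷ v ∷ Z
          F≡ = ++-assoc A (y ∷ e ∷ B) (u ∷ v ∷ Z)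
          F′ = A ++ y ∷ v ∷ Z ++ B ++ u ∷ e ∷ []
          chain-A = subst (Chain Link) F≡ chain
          chain-B = chain-++⁻ʳ (y ∷ e ∷ []) (chain-++⁻ʳ A chain-A)
          chain′ : Chain Link F′
          chain′ = chain-join A (chain-prefix A chain-A) (inj₂ y⟶v)
            (chain-ended chain-vZ ended-vZ (chain-join B (chain-prefix B chain-B) (inj₂ (u⟶ Se y⇾e)) [-]))
          ended′ : Ended F′
          ended′ = ended-++⁺ A (y ∷ ended-++ ended-vZ (ended-++⁺ B (u ∷ last Se)))
          perm : F′ ↭ F
          perm = ↭-trans (++⁺ˡ A (prep y (↭-trans (++-comm (v ∷ Z) (B ++ u ∷ e ∷ []))
            (↭-trans (↭-reflexive (++-assoc B (u ∷ e ∷ []) (v ∷ Z))) (shift₂ B u e (v ∷ Z))))))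
            (↭-reflexive (sym F≡))
          less : total F′ < total F
          less = ≤-reflexive (begin
            suc (total F′)
              ≡⟨ cong suc (trans (total-join A) (cong₂ (λ w r → total (A ∷ʳ y) + (w + r)) weight-yv
                   (trans (total-ended ended-vZ) (cong (total (v ∷ Z) +_) (total-join-S B Se))))) ⟩
            suc (total (A ∷ʳ y) + (0 + (total (v ∷ Z) + (total (B ∷ʳ u) + 0))))
              ≡⟨ rearrange (total (A ∷ʳ y)) (total (B ∷ʳ u)) (total (v ∷ Z)) ⟩
            total (A ∷ʳ y) + (total (B ∷ʳ u) + (1 + total (v ∷ Z)))
              ≡⟨ cong (λ w → total (A ∷ʳ y) + (total (B ∷ʳ u) + (w + total (v ∷ Z)))) weight-uv ⟨
            total (A ∷ʳ y) + (total (B ∷ʳ u) + (weight u v + total (v ∷ Z)))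
              ≡⟨ cong (total (A ∷ʳ y) +_) (total-join B) ⟨
            total (A ∷ʳ y) + total (B ++ u ∷ v ∷ Z)
              ≡⟨ total-join-S A Se ⟨
            total (A ++ y ∷ e ∷ B ++ u ∷ v ∷ Z)
              ≡⟨ cong total F≡ ⟨
            total F ∎)
            where
            open ≡-Reasoning
            rearrange : ∀ a b c → suc (a + (0 + (c + (b + 0)))) ≡ a + (b + (1 + c))
            rearrange = solve-∀

        -- The S-vertex `s` between `v` and `y` puts them on different paths. The block from `v` to
        -- `s` moves behind `y`, and `e` moves behind `u`.
        swap-after : ∀ {e s} A B C → Z ≡ A ++ s ∷ B ++ y ∷ e ∷ C → S s → S e → y ⇾ e → Better
        swap-after {e} {s} A B C refl Ss Se y⇾e = F′ , layout chain′ ended′ (↭-trans perm covers) , less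
          where
          F′ = L ++ u ∷ e ∷ B ++ y ∷ v ∷ A ++ s ∷ C
          chain-B = chain-++⁻ʳ (s ∷ []) (chain-++⁻ʳ (v ∷ A) chain-vZ)
          chain-C = chain-++⁻ʳ (y ∷ e ∷ []) (chain-++⁻ʳ B chain-B)
          ended-C = ended-++⁻ (y ∷ e ∷ []) (ended-++⁻ B (ended-++⁻ (s ∷ []) (ended-++⁻ (v ∷ A) ended-vZ)))
          ended-As : Ended (v ∷ A ++ s ∷ [])
          ended-As = ended-S (v ∷ A) Ss []
          chain-vAsC : Chain Link (v ∷ A ++ s ∷ C)
          chain-vAsC = subst (Chain Link) (++-assoc (v ∷ A) (s ∷ []) C)
            (chain-ended (chain-prefix (v ∷ A) chain-vZ) ended-As chain-C)
          from-e : ∀ B → Chain Link (B ++ y ∷ e ∷ C) → Chain Link (e ∷ B ++ y ∷ v ∷ A ++ s ∷ C)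
          from-e B c = chain-ended {A = e ∷ []} [-] (last Se) (chain-join B (chain-prefix B c) (inj₂ y⟶v) chain-vAsC)
          chain′ : Chain Link F′
          chain′ = chain-join L (chain-prefix L chain) (inj₂ (u⟶ Se y⇾e)) (from-e B chain-B)
          ended′ : Ended F′
          ended′ = ended-++⁺ L (u ∷ ended-++ (last Se) (ended-++⁺ B (y ∷ ended-S (v ∷ A) Ss ended-C)))
          perm : F′ ↭ F
          perm = ++⁺ˡ L (prep u (↭-sym (↭-trans
            (++⁺ˡ (v ∷ A) (↭-trans (prep s (shift₂ B y e C)) (swap s e ↭-refl)))
            (↭-trans (shift e (v ∷ A) (s ∷ B ++ y ∷ C)) (prep e (swap-blocks (v ∷ A) s B y C))))))
          less : total F′ < total F
          less = ≤-reflexive (begin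
            suc (total F′)
              ≡⟨ cong suc (trans (total-join-S L Se) (cong (total (L ∷ʳ u) +_)
                   (trans (total-join B) (cong₂ (λ w r → total (B ∷ʳ y) + (w + r)) weight-yv (total-S (v ∷ A) Ss))))) ⟩
            suc (total (L ∷ʳ u) + (total (B ∷ʳ y) + (0 + (total (v ∷ A) + total C))))
              ≡⟨ rearrange (total (L ∷ʳ u)) (total (B ∷ʳ y)) (total (v ∷ A)) (total C) ⟩
            total (L ∷ʳ u) + (1 + (total (v ∷ A) + (total (B ∷ʳ y) + total C)))
              ≡⟨ cong₂ (λ w r → total (L ∷ʳ u) + (w + r)) weight-uv
                   (trans (total-S (v ∷ A) Ss) (cong (total (v ∷ A) +_) (total-join-S B Se))) ⟨
            total (L ∷ʳ u) + (weight u v + total (v ∷ Z))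
              ≡⟨ total-join L ⟨
            total F ∎)
            where
            open ≡-Reasoning
            rearrange : ∀ a b c d → suc (a + (b + (0 + (c + d)))) ≡ a + (1 + (c + (b + d)))
            rearrange = solve-∀

        no-step : ¬ v ⟶ y
        no-step (toS _ Sy _) = Ty Sy
        no-step (forward f) = no-digon Ty Tv y⇾v (Fwd.step f)
        no-step (backward g) = ¬neg-y (Bwd.neg g)

        -- The step cannot come from a reversed arc `b → v`: for `b = u` it would need `β`, making
        -- `x` negative, and for other `b` the condition `α` makes `b` positive.
        next-v : ∀ {b} → T b → v ⟶ b → v ⇾ b × Pos b
        next-v Tb (toS _ Sb _) = contradiction Sb Tb
        next-v Tb (forward f) = Fwd.step f , Fwd.pos f
        next-v {b} Tb (backward g) with b ≟ u
        ... | yes refl = ⊥-elim (¬neg-x (Bwd.pos⇒β g pos u⇾x x≢v))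
        ... | no b≢u = ⊥-elim (pos-neg (source∈ (Bwd.step g)) Tb (αuv (Bwd.step g) b≢u) (Bwd.neg g))

        no-S-free : ∀ {e} A C → Z ≡ A ++ y ∷ e ∷ C → All T A → S e → ¬ y ⇾ e
        no-S-free [] C refl TA Se y⇾e = no-step (link-T Tv (Linked.head chain-vZ))
        no-S-free {e} (b ∷ A) C refl TA@(Tb ∷ _) Se y⇾e
          with v⇾b , pos-b ← next-v Tb (link-T Tv (Linked.head chain-vZ))
          with A′ , b′ , eq ← snoc b A = close (link-T Tb′ (chain-link (v ∷ A′)
            (subst (Chain Link) (trans (cong (λ l → v ∷ l ++ y ∷ e ∷ C) eq) (++-assoc (v ∷ A′) (b′ ∷ []) _)) chain-vZ)))
          where
          b′∈ : b′ ∈ b ∷ A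
          b′∈ = subst (b′ ∈_) (sym eq) (∈-++⁺ʳ A′ (here refl))
          Tb′ : T b′
          Tb′ = All.lookup TA b′∈
          close : ¬ b′ ⟶ y
          close (toS _ Sy _) = Ty Sy
          close (backward g) = ¬neg-y (Bwd.neg g)
          close (forward f) = no-cycle Tb Tb′ v⇾b pos-b (Fwd.step f) (Fwd.neg⇒α f)
            (λ { refl → unique-disjoint L uniq x∈L (there (there (∈-++⁺ˡ b′∈))) }) Se y⇾e

        link-y : ∀ P {e Q} → F ≡ P ++ y ∷ e ∷ Q → y ⟶ e
        link-y P F≡ = link-T Ty (chain-link P (subst (Chain Link) F≡ chain))

        swapped : Better
        swapped with ∈-++⁻ L y∈F
        ... | inj₂ (here y≡u) = contradiction y≡u y≢u
        ... | inj₂ (there (here refl)) = contradiction y⇾v irrefl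
        swapped | inj₁ i with ∈-∃++ i
        -- Here the successor of `y` is `u` itself.
        ... | A , [] , L≡ = case next-y (link-y A F≡) (⇾⇒≢ u⇾v) of λ
              { (inj₁ (Su , _)) → contradiction Su Tu ; (inj₂ (_ , u⇾u)) → contradiction u⇾u irrefl }
          where F≡ = trans (cong (_++ u ∷ v ∷ Z) L≡) (++-assoc A (y ∷ []) _)
        ... | A , e ∷ B , L≡ = case next-y (link-y A F≡) e≢v of λ
              { (inj₁ (Se , y⇾e)) → swap-before A B L≡ Se y⇾e
              ; (inj₂ (g , e⇾u)) → let σ , Sσ , y⇾σ = sink-y in isolated {P = A} g e⇾u F≡ Sσ y⇾σ }
          where
          F≡ = trans (cong (_++ u ∷ v ∷ Z) L≡) (++-assoc A (y ∷ e ∷ B) _)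
          e≢v : e ≢ v
          e≢v refl = unique-disjoint L uniq (subst (e ∈_) (sym L≡) (∈-++⁺ʳ A (there (here refl)))) (there (here refl))
        swapped | inj₂ (there (there i)) with ∈-∃++ i
        ... | A , C , refl with ended-next Ty (ended-++⁻ (v ∷ A) ended-vZ)
        ...   | e , C′ , refl = case next-y (link-y (L ++ u ∷ v ∷ A) F≡) e≢v of λ
              { (inj₁ (Se , y⇾e)) → behind Se y⇾e
              ; (inj₂ (g , e⇾u)) → let σ , Sσ , y⇾σ = sink-y in isolated {P = L ++ u ∷ v ∷ A} g e⇾u F≡ Sσ y⇾σ }
          where
          F≡ : F ≡ (L ++ u ∷ v ∷ A) ++ y ∷ e ∷ C′
          F≡ = sym (++-assoc L (u ∷ v ∷ A) _)
          e≢v : e ≢ v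
          e≢v refl = unique⇒∉ (unique-++⁻ʳ (u ∷ []) (unique-++⁻ʳ L uniq)) (∈-++⁺ʳ A (there (here refl)))
          behind : S e → y ⇾ e → Better
          behind Se y⇾e with any? S? A
          ... | no ¬S = contradiction y⇾e (no-S-free A C′ refl (All.¬Any⇒All¬ A ¬S) Se)
          ... | yes j with s , s∈ , Ss ← find j with P , Q , A≡ ← ∈-∃++ s∈ =
                swap-after P Q C′ (trans (cong (_++ y ∷ e ∷ C′) A≡) (++-assoc P (s ∷ Q) _)) Ss Se y⇾e

    improved : ∃ λ F′ → Layout F′ × total F′ < total F
    improved with y , y≢u , y⇾v ← inn Tu Tv u⇾v = Swap.swapped y≢u y⇾v

-- From layouts to BE-paths

module Straighten {V : Set} (𝕊 : Setting V) (W : List V) (red : Reduced 𝕊 W) where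
  open Star 𝕊 W red public

  -- Paths of both orientations meet at u.
  Turn : V → V → V → Set
  Turn x u v = (Bwd u x × Fwd u v) ⊎ (Fwd x u × Bwd v u)

  BadTurn : List V → Set
  BadTurn F = ∃₂ λ L x → ∃₂ λ u v → ∃ λ Z → F ≡ L ++ x ∷ u ∷ v ∷ Z × Turn x u v

  badTurn-++ : ∀ A {F} → BadTurn F → BadTurn (A ++ F)
  badTurn-++ A (L , x , u , v , Z , F≡ , turn) =
    A ++ L , x , u , v , Z , trans (cong (A ++_) F≡) (sym (++-assoc A L _)) , turn

  module _ {s : V} {rest : List V} (Ss : S s) where

    -- After a kept arc the next arc is kept too, or there is a turn. The last vertex before `s` is
    -- `Pos`, so its edge to `s` points to `s`.
    outward : ∀ {t t′} ts → Fwd t t′ → All T ts → Chain Link (t′ ∷ ts ++ s ∷ rest) →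
      BadTurn (t ∷ t′ ∷ ts ++ s ∷ rest) ⊎ Chain _⇾_ (t′ ∷ ts ∷ʳ s)
    outward [] f _ (r ∷ _) with link-T (Fwd.Tb f) r
    ... | toS _ _ (inj₁ t′⇾s) = inj₂ (t′⇾s ∷ [-])
    ... | toS _ _ (inj₂ s⇾t′) = contradiction s⇾t′ (Fwd.pos f Ss)
    ... | forward g = contradiction Ss (Fwd.Tb g)
    ... | backward g = contradiction Ss (Bwd.Ta g)
    outward (t″ ∷ ts) f (Tt″ ∷ Ts) (r ∷ c) with link-T (Fwd.Tb f) r
    ... | toS _ St″ _ = contradiction St″ Tt″
    ... | backward g = inj₁ ([] , _ , _ , _ , _ , refl , inj₂ (f , g))
    ... | forward g with outward ts g Ts c
    ...   | inj₁ bad = inj₁ (badTurn-++ (_ ∷ []) bad)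
    ...   | inj₂ d = inj₂ (Fwd.step g ∷ d)

    inward : ∀ {t t′} ts → Bwd t′ t → All T ts → Chain Link (t′ ∷ ts ++ s ∷ rest) →
      BadTurn (t ∷ t′ ∷ ts ++ s ∷ rest) ⊎ Chain (flip _⇾_) (t′ ∷ ts ∷ʳ s)
    inward [] f _ (r ∷ _) with link-T (Bwd.Ta f) r
    ... | toS _ _ (inj₁ t′⇾s) = contradiction t′⇾s (Bwd.neg f Ss)
    ... | toS _ _ (inj₂ s⇾t′) = inj₂ (s⇾t′ ∷ [-])
    ... | forward g = contradiction Ss (Fwd.Tb g)
    ... | backward g = contradiction Ss (Bwd.Ta g)
    inward (t″ ∷ ts) f (Tt″ ∷ Ts) (r ∷ c) with link-T (Bwd.Ta f) r
    ... | toS _ St″ _ = contradiction St″ Tt″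
    ... | forward g = inj₁ ([] , _ , _ , _ , _ , refl , inj₁ (f , g))
    ... | backward g with inward ts g Ts c
    ...   | inj₁ bad = inj₁ (badTurn-++ (_ ∷ []) bad)
    ...   | inj₂ d = inj₂ (Bwd.step g ∷ d)

    straighten : ∀ ts → All T ts → Chain Link (ts ++ s ∷ rest) →
      BadTurn (ts ++ s ∷ rest) ⊎ ∃ λ P → SPath P × P ↭ ts ∷ʳ s
    straighten [] _ _ = inj₂ (_ , begins Ss [] [-] , ↭-refl)
    straighten (t ∷ []) Ts@(Tt ∷ []) (r ∷ _) with link-T Tt r
    ... | toS _ _ (inj₁ t⇾s) = inj₂ (_ , ends Ss Ts (t⇾s ∷ [-]) , ↭-refl)
    ... | toS _ _ (inj₂ s⇾t) = inj₂ (_ , begins Ss Ts (s⇾t ∷ [-]) , swap _ _ ↭-refl)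
    ... | forward g = contradiction Ss (Fwd.Tb g)
    ... | backward g = contradiction Ss (Bwd.Ta g)
    straighten (t ∷ t′ ∷ ts) TTs@(Tt ∷ Tt′ ∷ Ts) (r ∷ c) with link-T Tt r
    ... | toS _ St′ _ = contradiction St′ Tt′
    ... | forward g with outward ts g Ts c
    ...   | inj₁ bad = inj₁ bad
    ...   | inj₂ d = inj₂ (_ , ends Ss TTs (Fwd.step g ∷ d) , ↭-refl)
    straighten (t ∷ t′ ∷ ts) TTs@(Tt ∷ Tt′ ∷ Ts) (r ∷ c) | backward g with inward ts g Ts c
    ...   | inj₁ bad = inj₁ bad
    ...   | inj₂ d = inj₂ (_ , begins Ss (All-resp-↭ (↭-sym (↭-reverse (t ∷ t′ ∷ ts))) TTs)
              (subst (Chain _⇾_) (reverse-++ (t ∷ t′ ∷ ts) (s ∷ [])) (chain-reverse (Bwd.step g ∷ d)))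
              , ↭-trans (prep s (↭-reverse (t ∷ t′ ∷ ts))) (∷↭∷ʳ s (t ∷ t′ ∷ ts)))

  first-S : ∀ {F} → Ended F → F ≡ [] ⊎ ∃₂ λ ts s → ∃ λ rest → F ≡ ts ++ s ∷ rest × All T ts × S s × Ended rest
  first-S [] = inj₁ refl
  first-S (last Ss) = inj₂ ([] , _ , [] , refl , [] , Ss , [])
  first-S (a ∷ e) with S? a
  ... | yes Sa = inj₂ ([] , a , _ , refl , [] , Sa , e)
  ... | no Ta with inj₂ (ts , s , rest , F≡ , Ts , Ss , e′) ← first-S e =
        inj₂ (a ∷ ts , s , rest , cong (a ∷_) F≡ , Ta ∷ Ts , Ss , e′)

  cut : ∀ n F → length F ≤ n → Chain Link F → Ended F → BadTurn F ⊎ SPartition F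
  cut n F le c e with first-S e
  ... | inj₁ refl = inj₂ ([] , [] , ↭-refl)
  cut zero _ le c e | inj₂ ([] , s , rest , refl , _) with () ← le
  cut zero _ le c e | inj₂ (_ ∷ _ , s , rest , refl , _) with () ← le
  cut (suc n) F le c e | inj₂ (ts , s , rest , refl , Ts , Ss , e′)
    with straighten Ss ts Ts c
       | cut n rest (≤-pred (≤-trans (m≤n+m _ (length ts)) (subst (_≤ suc n) (length-++ ts) le)))
           (chain-++⁻ʳ (s ∷ []) (chain-++⁻ʳ ts c)) e′
  ... | inj₁ bad | _ = inj₁ bad
  ... | inj₂ _ | inj₁ bad = inj₁ (badTurn-++ ts (badTurn-++ (s ∷ []) bad))
  ... | inj₂ (P , ok , P↭) | inj₂ (Ps , oks , e″) = inj₂ (P ∷ Ps , ok ∷ oks ,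
        ↭-trans (++⁺ʳ (concat Ps) P↭) (↭-trans (↭-reflexive (++-assoc ts (s ∷ []) _)) (++⁺ˡ ts (prep s e″))))

module Solve {V : Set} (𝕊 : Setting V) (W : List V) (red : Reduced 𝕊 W) (uniq : Unique W)
  (maximum : ∀ A → AllPairs (λ a b → ¬ Paths.Adj 𝕊 a b) A → A ⊑ W → length A ≤ length (filter (Setting.S? 𝕊) W)) where

  open Straighten 𝕊 W red
  private module Op = Straighten (op 𝕊) W (reduced-op red)

  private
    -- Reversal interchanges `Pos` with `Neg` and `α` with `β`, thus kept with reversed arcs.
    -- Layouts remain layouts, and the second kind of turn becomes the first.
    bwd-op : ∀ {a b} → Bwd a b → Op.Fwd b a
    bwd-op (bwd Ta Tb r n c) = Op.fwd Tb Ta r n c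

    fwd-op : ∀ {a b} → Fwd a b → Op.Bwd b a
    fwd-op (fwd Ta Tb r p c) = Op.bwd Tb Ta r p c

    link-op : ∀ {a b} → Link a b → Op.Link a b
    link-op (inj₁ Sa) = inj₁ Sa
    link-op (inj₂ (toS Ta Sb r)) = inj₂ (Op.toS Ta Sb (Sum.swap r))
    link-op (inj₂ (forward f)) = inj₂ (Op.backward (fwd-op f))
    link-op (inj₂ (backward f)) = inj₂ (Op.forward (bwd-op f))

    link-op⁻ : ∀ {a b} → Op.Link a b → Link a b
    link-op⁻ (inj₁ Sa) = inj₁ Sa
    link-op⁻ (inj₂ (Op.toS Ta Sb r)) = inj₂ (toS Ta Sb (Sum.swap r))
    link-op⁻ (inj₂ (Op.forward (Op.fwd Ta Tb r p c))) = inj₂ (backward (bwd Tb Ta r p c))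
    link-op⁻ (inj₂ (Op.backward (Op.bwd Ta Tb r p c))) = inj₂ (forward (fwd Tb Ta r p c))

    layout-op : ∀ {F} → Layout F → Op.Layout F
    layout-op (layout c e p) = Op.layout (Linked.map link-op c) e p

    layout-op⁻ : ∀ {F} → Op.Layout F → Layout F
    layout-op⁻ (Op.layout c e p) = layout (Linked.map link-op⁻ c) e p

    weight-op : ∀ a b → Op.weight a b ≡ weight a b
    weight-op a b = cong (if_then 1 else 0) (does-⇔ (mk⇔
      (λ { (inj₁ (Op.hot Ta Tb r n p)) → inj₂ (hot Tb Ta r p n) ; (inj₂ (Op.hot Ta Tb r n p)) → inj₁ (hot Tb Ta r p n) })
      (λ { (inj₁ (hot Ta Tb r n p)) → inj₂ (Op.hot Tb Ta r p n) ; (inj₂ (hot Ta Tb r n p)) → inj₁ (Op.hot Tb Ta r p n) }))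
      (Op.hotPair? a b) (hotPair? a b))

    total-op : ∀ F → Op.total F ≡ total F
    total-op [] = refl
    total-op (a ∷ []) = refl
    total-op (a ∷ b ∷ F) = cong₂ _+_ (weight-op a b) (total-op (b ∷ F))

    improve-layout : ∀ {F} → Layout F → BadTurn F → ∃ λ F′ → Layout F′ × total F′ < total F
    improve-layout {F} lay (L , x , u , v , Z , refl , turn)
      with F≡ ← ++-assoc L (x ∷ []) (u ∷ v ∷ Z)
      with uniq′ ← subst Unique (sym F≡) (unique-resp-↭ (↭-sym (Layout.covers lay)) uniq) | turn
    ... | inj₁ (ux , uv) = let F′ , lay′ , less = Fix.improved uniq′ (subst Layout (sym F≡) lay) (∈-++⁺ʳ L (here refl)) ux uv
          in F′ , lay′ , subst (total F′ <_) (cong total F≡) less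
    ... | inj₂ (xu , vu) =
          let F′ , lay′ , less = Op.Fix.improved uniq′ (layout-op (subst Layout (sym F≡) lay)) (∈-++⁺ʳ L (here refl)) (fwd-op xu) (bwd-op vu)
          in F′ , layout-op⁻ lay′ , subst₂ _<_ (total-op F′) (trans (total-op ((L ∷ʳ x) ++ u ∷ v ∷ Z)) (cong total F≡)) less

    untangle : ∀ n F → total F ≤ n → Layout F → SPartition W
    untangle n F le lay with cut (length F) F ≤-refl (Layout.chain lay) (Layout.ended lay)
    ... | inj₂ (Ps , oks , e) = Ps , oks , ↭-trans e (Layout.covers lay)
    ... | inj₁ bad with F′ , lay′ , less ← improve-layout lay bad = continue n le
      where
      continue : ∀ n → total F ≤ n → SPartition W
      continue zero le with () ← ≤-trans less le
      continue (suc n) le = untangle n F′ (≤-pred (≤-trans less le)) lay′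

    open GallaiMilgram _⟶?_

    #S : List V → ℕ
    #S A = length (filter S? A)

    #S-++ : ∀ A B → #S (A ++ B) ≡ #S A + #S B
    #S-++ A B = trans (cong length (filter-++ S? A B)) (length-++ (filter S? A))

    -- S-vertices have no out-arcs in the redirected digraph, so only the last vertex of a path can
    -- be one.
    path-#S : ∀ {a A} → Chain _⟶_ (a ∷ A) → #S (a ∷ A) ≡ 0 ⊎ (#S (a ∷ A) ≡ 1 × Ended (a ∷ A))
    path-#S {a} {[]} c with S? a
    ... | yes Sa = inj₂ (refl , last Sa)
    ... | no Ta = inj₁ refl
    path-#S {a} {b ∷ A} (r ∷ c) rewrite filter-reject S? {xs = b ∷ A} (⟶⇒T r) with path-#S c
    ... | inj₁ eq = inj₁ eq
    ... | inj₂ (eq , e) = inj₂ (eq , a ∷ e)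

    #S-cover : ∀ ps → All IsPath ps → #S (cover ps) ≤ length ps
    #S-cover [] [] = z≤n
    #S-cover (p ∷ ps) (c ∷ cs) rewrite #S-++ (vertices p) (cover ps) with path-#S c
    ... | inj₁ eq = subst (λ k → k + #S (cover ps) ≤ _) (sym eq) (m≤n⇒m≤1+n (#S-cover ps cs))
    ... | inj₂ (eq , _) = subst (λ k → k + #S (cover ps) ≤ _) (sym eq) (s≤s (#S-cover ps cs))

    -- Each path holds at most one S-vertex, and there are no more paths than S-vertices, so every
    -- path ends in S.
    concatenate : ∀ ps → All IsPath ps → length ps ≤ #S (cover ps) → Chain Link (cover ps) × Ended (cover ps)
    concatenate [] [] le = [] , []
    concatenate (p ∷ ps) (c ∷ cs) le rewrite #S-++ (vertices p) (cover ps) with path-#S c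
    ... | inj₁ eq with () ← n≮n _ (≤-trans (subst (λ k → _ ≤ k + #S (cover ps)) eq le) (#S-cover ps cs))
    ... | inj₂ (eq , e) with c′ , e′ ← concatenate ps cs (≤-pred (subst (λ k → _ ≤ k + #S (cover ps)) eq le)) =
          chain-ended (Linked.map inj₂ c) e c′ , ended-++ e e′

  solution : SPartition W
  solution with gallai-milgram (#S W) W bound
    where
    bound : ∀ A → AllPairs Free A → A ⊑ W → length A ≤ #S W
    bound A free = maximum A (AllPairs.map nonadjacent free)
      where
      nonadjacent : ∀ {a b} → Free a b → ¬ Adj a b
      nonadjacent (¬ab , ¬ba) (inj₁ r) with arc⇒⟶ r
      ... | inj₁ ab = ¬ab ab
      ... | inj₂ ba = ¬ba ba
      nonadjacent (¬ab , ¬ba) (inj₂ r) with arc⇒⟶ r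
      ... | inj₁ ba = ¬ba ba
      ... | inj₂ ab = ¬ab ab
  ... | ps , paths , cov , le
    with c , e ← concatenate ps paths (≤-trans le (≤-reflexive (↭-length (filter-↭ S? (↭-sym cov))))) =
      untangle (total (cover ps)) (cover ps) ≤-refl (layout c e cov)

-- The induction on the number of vertices

module _ {V : Set} (𝕊 : Setting V) where
  open Paths 𝕊
  open DecMembership _≟_ using (_∈?_)

  Maximum : List V → Set
  Maximum W = ∀ A → AllPairs (λ a b → ¬ Adj a b) A → A ⊑ W → length A ≤ length (filter S? W)

  filter-T : ∀ {us W} → All T us → filter S? (us ++ W) ≡ filter S? W
  filter-T [] = refl
  filter-T {W = W} (Tu ∷ Ts) = trans (filter-reject S? Tu) (filter-T {W = W} Ts)

  count-T : ∀ {us W W′} → W ↭ us ++ W′ → All T us → length (filter S? W) ≡ length (filter S? W′)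
  count-T {W′ = W′} e Ts = trans (↭-length (filter-↭ S? e)) (cong length (filter-T {W = W′} Ts))

  maximum-delete : ∀ {us W W′} → W ↭ us ++ W′ → All T us → Maximum W → Maximum W′
  maximum-delete {us} e Ts max A stab (ws , e′) = ≤-trans
    (max A stab (us ++ ws , ↭-trans (shifts A us) (↭-trans (++⁺ˡ us e′) (↭-sym e))))
    (≤-reflexive (count-T e Ts))

  module _ {W : List V} (uniq : Unique W) (max : Maximum W) where

    private
      module _ {us W′} (e : W ↭ us ++ W′) (Ts : All T us) (stab : AllPairs (λ a b → ¬ Adj a b) us)
        {Q : V → Set} (Q? : ∀ a → Dec (Q a)) (Q⊆S : ∀ {a} → Q a → S a)
        (free : ∀ {a} → a ∈ W → Q a → All (λ t → ¬ Adj t a) us) where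

        -- `us` together with the chosen S-vertices is stable, so it is no larger than S.
        replace : length us + length (filter Q? W′) ≤ length (filter S? W′)
        replace = ≤-trans (≤-reflexive (sym (length-++ us))) (≤-trans
          (max (us ++ filter Q? W′) (AllPairs.++⁺ stab among between) sub)
          (≤-reflexive (count-T e Ts)))
          where
          all-Q = All.all-filter Q? W′
          sub : us ++ filter Q? W′ ⊑ W
          sub with ws , e′ ← filter-⊑ Q? W′ =
            ws , ↭-trans (↭-reflexive (++-assoc us _ ws)) (↭-trans (++⁺ˡ us e′) (↭-sym e))
          among : AllPairs (λ a b → ¬ Adj a b) (filter Q? W′)
          among = go all-Q
            where
            go : ∀ {xs} → All Q xs → AllPairs (λ a b → ¬ Adj a b) xs
            go [] = []
            go (q ∷ qs) = All.map (λ q′ → λ { (inj₁ r) → stable (Q⊆S q) (Q⊆S q′) r ; (inj₂ r) → stable (Q⊆S q′) (Q⊆S q) r }) qs ∷ go qs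
          between : All (λ t → All (λ a → ¬ Adj t a) (filter Q? W′)) us
          between = All.tabulate λ t∈ → All.tabulate λ a∈ →
            All.lookup (free (∈-resp-↭ (↭-sym e) (∈-++⁺ʳ us (⊑-∈ (filter-⊑ Q? W′) a∈))) (All.lookup all-Q a∈)) t∈

      adj? : ∀ a b → Dec (Adj a b)
      adj? a b = (a ⇾? b) ⊎-dec (b ⇾? a)

    dominated : ∀ {t} → t ∈ W → T t → ∃ λ σ → σ ∈ W × S σ × Adj σ t
    dominated {t} t∈ Tt with any? (λ σ → S? σ ×-dec adj? σ t) W
    ... | yes i = find i
    ... | no ¬i with W′ , e ← ∈⇒↭ t∈ = contradiction
          (replace e (Tt ∷ []) ([] ∷ []) S? id (λ a∈ Sa → (λ adj → ¬i (lose a∈ (Sa , Sum.swap adj))) ∷ []))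
          (n≮n _)

    exchange : ∀ {a b m} → a ∈ W → b ∈ W → T a → T b → a ≢ b → ¬ Adj a b → S m →
      ∃ λ σ → σ ∈ W × S σ × σ ≢ m × (Adj σ a ⊎ Adj σ b)
    exchange {a} {b} {m} a∈ b∈ Ta Tb a≢b ¬adj Sm
      with any? (λ σ → S? σ ×-dec ¬? (σ ≟ m) ×-dec (adj? σ a ⊎-dec adj? σ b)) W
    ... | yes i = find i
    ... | no ¬i with W′ , e ← pick₂ a∈ b∈ a≢b = contradiction
          -- Dropping `m` costs at most one vertex since `W` has no repetitions, while `a` and `b`
          -- add two.
          (≤-trans (replace e (Ta ∷ Tb ∷ []) ((¬adj ∷ []) ∷ [] ∷ []) (others? S? _≟_ m) proj₁
            (λ { c∈ (Sc , c≢m) → (λ adj → ¬i (lose c∈ (Sc , c≢m , inj₁ (Sum.swap adj))))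
                               ∷ (λ adj → ¬i (lose c∈ (Sc , c≢m , inj₂ (Sum.swap adj)))) ∷ [] }))
            (filter-unique S? _≟_ m (unique-++⁻ʳ (a ∷ b ∷ []) (unique-resp-↭ e uniq))))
          (n≮n _)

  -- With arcs confined to `W`, statements about all neighbours need no side condition on membership
  -- in `W`.
  restrict : List V → Setting V
  restrict W = record
    { _≟_ = _≟_
    ; _⇾_ = λ a b → a ∈ W × b ∈ W × a ⇾ b
    ; _⇾?_ = λ a b → (a ∈? W) ×-dec (b ∈? W) ×-dec (a ⇾? b)
    ; irrefl = λ (_ , _ , r) → irrefl r
    ; anti = λ (a∈ , _ , ab) (_ , _ , cb) (_ , d∈ , cd) a≢c b≢d a≢d → d∈ , a∈ , anti ab cb cd a≢c b≢d a≢d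
    ; tri = λ (a∈ , b∈ , ab) (_ , c∈ , ac) (_ , _ , cb) →
        Sum.map (λ r → b∈ , a∈ , r) (Sum.map (λ r → c∈ , a∈ , r) (λ r → b∈ , c∈ , r)) (tri ab ac cb)
    ; S = S
    ; S? = S?
    ; stable = λ Sa Sb (_ , _ , r) → stable Sa Sb r
    }

  unrestrict : ∀ {W W′} → SPaths.SPartition (Setting._⇾_ (restrict W)) S W′ → SPartition W′
  unrestrict (Ps , oks , e) = Ps , All.map path oks , e
    where
    path : ∀ {P} → SPaths.SPath _ S P → SPath P
    path (SPaths.begins Ss Ts c) = begins Ss Ts (Linked.map (λ (_ , _ , r) → r) c)
    path (SPaths.ends Ss Ts c) = ends Ss Ts (Linked.map (λ (_ , _ , r) → r) c)

  module Step (W : List V) (uniq : Unique W) (max : Maximum W)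
    (ih : ∀ u us {W′} → W ↭ u ∷ us ++ W′ → All T (u ∷ us) → SPartition W′) where

    private
      module R = Reductions 𝕊 W uniq ih
      module Rᵒ = Reductions (op 𝕊) W uniq (λ u us e Ts → partition-op (ih u us e Ts))

      OutStar InStar : V → V → Set
      OutStar u v = T u × T v × u ⇾ v × All (λ x → u ⇾ x → x ≡ v) W
      InStar u v = T u × T v × u ⇾ v × All (λ y → y ⇾ v → y ≡ u) W

      T-arc? : ∀ u v {X : Set} → Dec X → Dec (T u × T v × u ⇾ v × X)
      T-arc? u v X? = ¬? (S? u) ×-dec ¬? (S? v) ×-dec (u ⇾? v) ×-dec X?

      outStar? : ∀ u v → Dec (OutStar u v)
      outStar? u v = T-arc? u v (All.all? (λ x → (u ⇾? x) →-dec (x ≟ v)) W)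

      inStar? : ∀ u v → Dec (InStar u v)
      inStar? u v = T-arc? u v (All.all? (λ y → (y ⇾? v) →-dec (y ≟ u)) W)

      another : {X : V → Set} (X? : ∀ x → Dec (X x)) → ∀ {v} → ¬ All (λ x → X x → x ≡ v) W →
        ∃ λ x → x ∈ W × x ≢ v × X x
      another X? {v} ¬all with any? (λ x → ¬? (x ≟ v) ×-dec X? x) W
      ... | yes i = find i
      ... | no ¬i = contradiction (All.tabulate only) ¬all
        where
        only : ∀ {x} → x ∈ W → _ → x ≡ v
        only {x} x∈ Xx with x ≟ v
        ... | yes eq = eq
        ... | no x≢v = contradiction (lose x∈ (x≢v , Xx)) ¬i

      irreducible : (∀ {u v} → u ∈ W → v ∈ W → ¬ OutStar u v) → (∀ {u v} → u ∈ W → v ∈ W → ¬ InStar u v) →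
        R.Irreducible
      irreducible ¬out ¬in = record
        { out = λ i j Tu Tv r → another (_ ⇾?_) (λ all → ¬out i j (Tu , Tv , r , all))
        ; inn = λ i j Tu Tv r → another (_⇾? _) (λ all → ¬in i j (Tu , Tv , r , all)) }

    -- The order of the cases matters: digons are handled with second neighbours at hand, and
    -- triangles also with all digons in T excluded.
    step : SPartition W
    step with search₂ outStar? W
    ... | inj₁ (u , v , u∈ , v∈ , Tu , Tv , u⇾v , only) =
          partition-op (Rᵒ.star v∈ u∈ Tv Tu u⇾v (All.lookup only))
    ... | inj₂ ¬out with search₂ inStar? W
    ...   | inj₁ (u , v , u∈ , v∈ , Tu , Tv , u⇾v , only) = R.star u∈ v∈ Tu Tv u⇾v (All.lookup only)
    ...   | inj₂ ¬in with search₂ (λ u v → T-arc? u v (v ⇾? u)) W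
    ...     | inj₁ (u , v , u∈ , v∈ , Tu , Tv , u⇾v , v⇾u) =
              R.Digon.solve (dominated uniq max) (irreducible ¬out ¬in) Tu Tv u⇾v v⇾u (proj₂ (pick₂ u∈ v∈ (⇾⇒≢ u⇾v)))
    ...     | inj₂ ¬digon with search₂ (λ u v → T-arc? u v (any? (λ z → (u ⇾? z) ×-dec (z ⇾? v)) W)) W
    ...       | inj₁ (u , v , u∈ , v∈ , Tu , Tv , u⇾v , through) = triangle (find through)
      where
      irr = irreducible ¬out ¬in
      irrᵒ : Rᵒ.Irreducible
      irrᵒ = record
        { out = λ i j Tu Tv r → R.Irreducible.inn irr j i Tv Tu r
        ; inn = λ i j Tu Tv r → R.Irreducible.out irr j i Tv Tu r }
      triangle : (∃ λ z → z ∈ W × u ⇾ z × z ⇾ v) → SPartition W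
      -- `tri` produces a digon on the triangle. As T contains none, `z` lies in S and is one of its
      -- ends.
      triangle (z , z∈ , u⇾z , z⇾v) with tri u⇾v u⇾z z⇾v | S? z
      ... | inj₁ v⇾u | _ = contradiction (Tu , Tv , u⇾v , v⇾u) (¬digon u∈ v∈)
      ... | inj₂ (inj₁ z⇾u) | no Tz = contradiction (Tu , Tz , u⇾z , z⇾u) (¬digon u∈ z∈)
      ... | inj₂ (inj₂ v⇾z) | no Tz = contradiction (Tv , Tz , v⇾z , z⇾v) (¬digon v∈ z∈)
      ... | inj₂ (inj₁ z⇾u) | yes Sz =
            R.Triangle.solve (dominated uniq max) irr (λ i j Ta Tb r r′ → ¬digon i j (Ta , Tb , r , r′))
              Tu Tv u⇾v (proj₂ (pick₂ u∈ v∈ (⇾⇒≢ u⇾v))) Sz z∈ z⇾u u⇾z z⇾v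
      ... | inj₂ (inj₂ v⇾z) | yes Sz = partition-op
            (Rᵒ.Triangle.solve (λ i Tt → let σ , σ∈ , Sσ , adj = dominated uniq max i Tt in σ , σ∈ , Sσ , Sum.swap adj)
              irrᵒ (λ i j Ta Tb r r′ → ¬digon j i (Tb , Ta , r , r′))
              Tv Tu u⇾v (proj₂ (pick₂ v∈ u∈ (⇾⇒≢ u⇾v ∘ sym))) Sz z∈ v⇾z z⇾v u⇾z)
    ...       | inj₂ ¬through = unrestrict (Solve.solution (restrict W) W reduced uniq maximum)
      where
      within : ∀ {a b} → a ∈ W → b ∈ W → Adj a b → Paths.Adj (restrict W) a b
      within a∈ b∈ = Sum.map (λ r → a∈ , b∈ , r) (λ r → b∈ , a∈ , r)

      maximum : ∀ A → AllPairs (λ a b → ¬ Paths.Adj (restrict W) a b) A → A ⊑ W → length A ≤ length (filter S? W)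
      maximum A stab A⊑ = max A
        (allPairs-map-All (λ a∈ b∈ ¬adj adj → ¬adj (within a∈ b∈ adj)) (All.tabulate (⊑-∈ A⊑)) stab) A⊑

      reduced : Reduced (restrict W) W
      reduced = record
        { source∈ = proj₁
        ; target∈ = proj₁ ∘ proj₂
        ; out = λ { Tu Tv (u∈ , v∈ , r) →
            let x , x∈ , x≢v , u⇾x = another (_ ⇾?_) (λ all → ¬out u∈ v∈ (Tu , Tv , r , all))
            in x , x≢v , u∈ , x∈ , u⇾x }
        ; inn = λ { Tu Tv (u∈ , v∈ , r) →
            let y , y∈ , y≢u , y⇾v = another (_⇾? _) (λ all → ¬in u∈ v∈ (Tu , Tv , r , all))
            in y , y≢u , y∈ , v∈ , y⇾v }
        ; no-digon = λ { Ta Tb (a∈ , b∈ , r) (_ , _ , r′) → ¬digon a∈ b∈ (Ta , Tb , r , r′) }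
        ; no-through = λ { Ta Tb (a∈ , b∈ , r) (_ , z∈ , az) (_ , _ , zb) →
            ¬through a∈ b∈ (Ta , Tb , r , lose z∈ (az , zb)) }
        ; dominated = λ i Tt → let σ , σ∈ , Sσ , adj = dominated uniq max i Tt in σ , Sσ , within σ∈ i adj
        ; exchange = λ i j Ta Tb a≢b ¬adj Sm →
            let σ , σ∈ , Sσ , σ≢m , adj = exchange uniq max i j Ta Tb a≢b (¬adj ∘ within i j) Sm
            in σ , Sσ , σ≢m , Sum.map (within σ∈ i) (within σ∈ j) adj
        }

  partition : ∀ n W → length W ≤ n → Unique W → Maximum W → SPartition W
  partition n [] _ _ _ = [] , [] , ↭-refl
  partition (suc n) W@(_ ∷ _) le uniq max = Step.step W uniq max λ u us {W′} e Ts →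
    partition n W′ (≤-pred (≤-trans (s≤s (shorter us W′)) (subst (_≤ suc n) (↭-length e) le)))
      (unique-++⁻ʳ (u ∷ us) (unique-resp-↭ e uniq)) (maximum-delete e Ts max)
    where
    shorter : ∀ us W′ → length W′ ≤ length (us ++ W′)
    shorter us W′ = ≤-trans (m≤n+m _ (length us)) (≤-reflexive (sym (length-++ us)))

-- Transfer to subsets and induced subdigraphs

open import Data.Bool.Base using (T)
open import Relation.Nullary.Decidable using (T?)

card-tabulate : ∀ {A : Set} {P : A → Set} {k} (P? : ∀ a → Dec (P a)) (g : Fin k → A) (U : Subset k) →
  (∀ i → does (P? (g i)) ≡ Vec.lookup U i) → length (filter P? (tabulate g)) ≡ ∣ U ∣
card-tabulate P? g Vec.[] eq = refl
card-tabulate P? g (b Vec.∷ U) eq with does (P? (g zero)) | eq zero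
... | true | refl = cong suc (card-tabulate P? (g ∘ suc) U (eq ∘ suc))
... | false | refl = card-tabulate P? (g ∘ suc) U (eq ∘ suc)

∈ₛ?-lookup : ∀ {k} (U : Subset k) i → does (i ∈ₛ? U) ≡ Vec.lookup U i
∈ₛ?-lookup U i with i ∈ₛ? U | Vec.lookup U i in eq
... | yes i∈ | true = refl
... | no i∉ | false = refl
... | yes i∈ | false = case trans (sym eq) (Vec.[]=⇒lookup i∈) of λ ()
... | no i∉ | true = contradiction (Vec.lookup⇒[]= i U eq) i∉

module _ {k : ℕ} where
  open DecMembership (Fin._≟_ {k}) using (_∈?_)

  toSubset : List (Fin k) → Subset k
  toSubset A = Vec.tabulate (λ i → does (i ∈? A))

  toSubset⁻ : ∀ A {i} → i ∈ₛ toSubset A → i ∈ A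
  toSubset⁻ A {i} i∈ with i ∈? A | trans (sym (Vec.lookup∘tabulate (λ i → does (i ∈? A)) i)) (Vec.[]=⇒lookup i∈)
  ... | yes j | _ = j
  ... | no _ | ()

  -- `A ⊑ allFin k` excludes repetitions, so no entry of `A` is lost in passing to a subset.
  length≤∣toSubset∣ : ∀ A → A ⊑ allFin k → length A ≤ ∣ toSubset A ∣
  length≤∣toSubset∣ A (ws , e) = begin
    length A                                ≡⟨ cong length (filter-all (_∈? A) (All.tabulate id)) ⟨
    length (filter (_∈? A) A)               ≤⟨ m≤m+n _ _ ⟩
    length (filter (_∈? A) A) + length (filter (_∈? A) ws)
      ≡⟨ trans (cong length (filter-++ (_∈? A) A ws)) (length-++ (filter (_∈? A) A)) ⟨
    length (filter (_∈? A) (A ++ ws))       ≡⟨ ↭-length (filter-↭ (_∈? A) e) ⟩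
    length (filter (_∈? A) (allFin k))
      ≡⟨ card-tabulate (_∈? A) id (toSubset A) (λ i → sym (Vec.lookup∘tabulate (λ i → does (i ∈? A)) i)) ⟩
    ∣ toSubset A ∣                          ∎
    where open ≤-Reasoning

module _ (D : Digraph) (tac : ThreeAntiCirculant D) (¬boc : ¬ HasInducedBlockingOddCycle D)
  {m} (f : Fin m → Fin (n D)) (f-inj : Injective _≡_ _≡_ f) where

  private
    H = induced D m f

    _⟶ᴴ_ : Fin m → Fin m → Set
    a ⟶ᴴ b = Props._⇒_ H a b

    loop : ∀ {a} → ¬ a ⟶ᴴ a
    loop {a} r = subst T (loopless D (f a)) r

    arc≢ : ∀ {a b} → a ⟶ᴴ b → f a ≢ f b
    arc≢ r eq with refl ← f-inj eq = loop r

    anti : ∀ {a b c d} → a ⟶ᴴ b → c ⟶ᴴ b → c ⟶ᴴ d → a ≢ c → b ≢ d → a ≢ d → d ⟶ᴴ a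
    anti ab cb cd a≢c b≢d a≢d =
      tac _ _ _ _ (arc≢ ab) (a≢c ∘ f-inj) (a≢d ∘ f-inj) (arc≢ cb ∘ sym) (b≢d ∘ f-inj) (arc≢ cd) ab cb cd

    tri : ∀ {a b c} → a ⟶ᴴ b → a ⟶ᴴ c → c ⟶ᴴ b → b ⟶ᴴ a ⊎ c ⟶ᴴ a ⊎ b ⟶ᴴ c
    tri {a} {b} {c} ab ac cb with T? (arc H b a) | T? (arc H c a) | T? (arc H b c)
    ... | yes ba | _ | _ = inj₁ ba
    ... | no _ | yes ca | _ = inj₂ (inj₁ ca)
    ... | no _ | no _ | yes bc = inj₂ (inj₂ bc)
    -- Without the three reverse arcs, `a`, `b`, `c` is a blocking cycle of length 3, with the
    -- source `a` in first and the sink `b` in second place.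
    ... | no ¬ba | no ¬ca | no ¬bc = contradiction (0 , x , (λ {i} {j} → x-inj {i} {j}) , adjacency , source , sink) ¬boc
      where
      x : Fin 3 → Fin (n D)
      x zero = f a
      x (suc zero) = f b
      x (suc (suc zero)) = f c

      x-inj : Injective _≡_ _≡_ x
      x-inj {zero} {zero} _ = refl
      x-inj {zero} {suc zero} eq = contradiction eq (arc≢ ab)
      x-inj {zero} {suc (suc zero)} eq = contradiction eq (arc≢ ac)
      x-inj {suc zero} {zero} eq = contradiction (sym eq) (arc≢ ab)
      x-inj {suc zero} {suc zero} _ = refl
      x-inj {suc zero} {suc (suc zero)} eq = contradiction (sym eq) (arc≢ cb)
      x-inj {suc (suc zero)} {zero} eq = contradiction (sym eq) (arc≢ ac)
      x-inj {suc (suc zero)} {suc zero} eq = contradiction eq (arc≢ cb)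
      x-inj {suc (suc zero)} {suc (suc zero)} _ = refl

      source : ∀ i → ¬ T (arc D (x i) (f a))
      source zero = loop
      source (suc zero) = ¬ba
      source (suc (suc zero)) = ¬ca

      sink : ∀ i → ¬ T (arc D (f b) (x i))
      sink zero = ¬ba
      sink (suc zero) = loop
      sink (suc (suc zero)) = ¬bc

      Next : Fin 3 → Fin 3 → Set
      Next i j = CycleNext D i j ⊎ CycleNext D j i

      adjacency : ∀ i j → (Adjacent D (x i) (x j) → Next i j) × (Next i j → Adjacent D (x i) (x j))
      adjacency zero zero = (λ { (inj₁ r) → contradiction r loop ; (inj₂ r) → contradiction r loop })
                          , (λ { (inj₁ ()) ; (inj₂ ()) })
      adjacency (suc zero) (suc zero) = (λ { (inj₁ r) → contradiction r loop ; (inj₂ r) → contradiction r loop })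
                          , (λ { (inj₁ ()) ; (inj₂ ()) })
      adjacency (suc (suc zero)) (suc (suc zero)) =
        (λ { (inj₁ r) → contradiction r loop ; (inj₂ r) → contradiction r loop }) , (λ { (inj₁ ()) ; (inj₂ ()) })
      adjacency zero (suc zero) = (λ _ → inj₁ refl) , (λ _ → inj₁ ab)
      adjacency (suc zero) zero = (λ _ → inj₂ refl) , (λ _ → inj₂ ab)
      adjacency zero (suc (suc zero)) = (λ _ → inj₂ refl) , (λ _ → inj₁ ac)
      adjacency (suc (suc zero)) zero = (λ _ → inj₁ refl) , (λ _ → inj₂ ac)
      adjacency (suc zero) (suc (suc zero)) = (λ _ → inj₁ refl) , (λ _ → inj₂ cb)
      adjacency (suc (suc zero)) (suc zero) = (λ _ → inj₂ refl) , (λ _ → inj₁ cb)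

  beProperty : Props.BEProperty H
  beProperty U (stableU , maxU) = Ps , (All.map walk oks , cov) , All.map bePath oks
    where
    𝕊 : Setting (Fin m)
    𝕊 = record
      { _≟_ = Fin._≟_
      ; _⇾_ = _⟶ᴴ_
      ; _⇾?_ = λ a b → T? (arc H a b)
      ; irrefl = loop
      ; anti = anti
      ; tri = tri
      ; S = _∈ₛ U
      ; S? = _∈ₛ? U
      ; stable = λ a∈ b∈ r → stableU _ _ a∈ b∈ (inj₁ r)
      }
    open Paths 𝕊 using (Adj; SPath; SPartition; begins; ends)

    maximum : Maximum 𝕊 (allFin m)
    maximum A stab A⊑ = ≤-trans (length≤∣toSubset∣ A A⊑) (≤-trans (maxU (toSubset A) stableA)
      (≤-reflexive (sym (card-tabulate (_∈ₛ? U) id U (∈ₛ?-lookup U)))))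
      where
      stableA : Props.Stable H (toSubset A)
      stableA a b a∈ b∈ adj
        with allPairs-lookup (λ ¬adj → ¬adj ∘ Sum.swap) stab (toSubset⁻ A a∈) (toSubset⁻ A b∈)
      ... | inj₂ ¬adj = ¬adj adj
      ... | inj₁ refl = Sum.[ loop , loop ] adj

    parts : SPartition (allFin m)
    parts = partition 𝕊 (length (allFin m)) (allFin m) ≤-refl (allFin⁺ m) maximum

    Ps = proj₁ parts
    oks = proj₁ (proj₂ parts)
    cov = proj₂ (proj₂ parts)

    linked : ∀ {P} → Chain _⟶ᴴ_ P → Props.Linked H P
    linked [] = _
    linked [-] = _
    linked (r ∷ c) = r , linked c

    walk : ∀ {P} → SPath P → Props.IsWalkSeq H P
    walk (begins _ _ c) = linked c
    walk (ends {ts = []} _ _ c) = linked c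
    walk (ends {ts = _ ∷ _} _ _ c) = linked c

    bePath : ∀ {P} → SPath P → Props.BEPath H U P
    bePath (begins Ss Ts c) = inj₁ (_ , _ , refl , Ss , Ts)
    bePath (ends Ss Ts c) = inj₂ (_ , _ , refl , Ss , Ts)

theorem2 : (D : Digraph) → ThreeAntiCirculant D → ¬ HasInducedBlockingOddCycle D → BEDiperfect D
theorem2 D tac ¬boc m f f-inj = beProperty D tac ¬boc f f-inj
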